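{- Let $n\ge 2$ and $k\ge 1$ be integers and let $\mathbf y\in\{ -k,\dots,k\}^n$ be an unknown vector. There is an algorithm that chooses query vectors $\mathbf x^{(1)},\dots,\mathbf x^{(s)}$ and, given the answers $\|\mathbf x^{(j)}-\mathbf y\|_1$ for $j=1,\dots,s$, recovers $\mathbf y$ exactly, where $s=O\!\left(\min\left\{n,\frac{n\log k}{\log n}\right\}\right)$, and which runs in time polynomial in $n$ and $k$.
   Context: $\|\mathbf z\|_1=\sum_{i=1}^n |z_i|$. The algorithm learns about $\mathbf y$ only through the answers to its queries. The constant in the $O(\cdot)$ is absolute.
   Formalization: For k = 1 the stated bound is 0 queries (log 1 = 0), which is impossible since y in { -1,0,1}^n cannot be recovered without queries; log k is therefore read as log max(k,2), unchanged for all k ≥ 2. -}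

module Defs where

open import Data.Bool.Base using (Bool; true; false)
open import Data.Integer.Base as ℤ using (ℤ; +_; ∣_∣)
open import Data.List.Base using (List; []; _∷_)
open import Data.List.Membership.Propositional using (_∈_)
open import Data.List.Relation.Unary.All as All using (All; []; _∷_)
open import Data.Nat.Base using (ℕ; suc; _+_; _*_; _^_; _≤_; _⊔_)
open import Data.Product.Base using (_×_; _,_)
open import Data.Vec.Base as Vec using (Vec)
open import Data.Vec.Relation.Unary.All as VecAll using ()

‖_‖₁ : ∀ {n} → Vec ℤ n → ℕ
‖ z ‖₁ = Vec.sum (Vec.map ∣_∣ z)

_-ᵥ_ : ∀ {n} → Vec ℤ n → Vec ℤ n → Vec ℤ n
_-ᵥ_ = Vec.zipWith ℤ._-_

-- Membership in {-k,…,k}ⁿ.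
InBox : ∀ {n} → ℕ → Vec ℤ n → Set
InBox k z = VecAll.All (λ a → ∣ a ∣ ≤ k) z

-- Algorithms are programs of a first-order language over integers, Booleans,
-- pairs and lists, with while loops and one further instruction, the query.
-- The running time is the number of evaluation steps.  As on a unit-cost
-- random access machine, the only arithmetic is addition, subtraction and
-- comparison: t steps then produce integers of only O(t) more bits than the
-- input and the answers have, and lists and pairs are shared and never
-- compared, so polynomial time here is polynomial time on a Turing machine.

infixr 7 _⊗_

data Ty : Set where
  int bool : Ty
  list     : Ty → Ty
  _⊗_      : Ty → Ty → Ty

Ctx : Set
Ctx = List Ty

private
  variable
    Γ   : Ctx
    σ τ : Ty

-- `call f e` is a call of a closed, hence non-recursive, procedure;
-- `while e₀ c b` starts with the value of e₀ as its state and, as long as the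
-- test c holds of the state, replaces the state by the value of b.
data Tm (Γ : Ctx) : Ty → Set where
  var     : τ ∈ Γ → Tm Γ τ
  let′    : Tm Γ σ → Tm (σ ∷ Γ) τ → Tm Γ τ
  call    : Tm (σ ∷ []) τ → Tm Γ σ → Tm Γ τ
  lit     : ℤ → Tm Γ int
  add sub : Tm Γ int → Tm Γ int → Tm Γ int
  leq     : Tm Γ int → Tm Γ int → Tm Γ bool
  if      : Tm Γ bool → Tm Γ τ → Tm Γ τ → Tm Γ τ
  pair    : Tm Γ σ → Tm Γ τ → Tm Γ (σ ⊗ τ)
  fst     : Tm Γ (σ ⊗ τ) → Tm Γ σ
  snd     : Tm Γ (σ ⊗ τ) → Tm Γ τ
  nil     : Tm Γ (list τ)
  cons    : Tm Γ τ → Tm Γ (list τ) → Tm Γ (list τ)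
  uncons  : Tm Γ (list σ) → Tm Γ τ → Tm (σ ∷ list σ ∷ Γ) τ → Tm Γ τ
  while   : Tm Γ σ → Tm (σ ∷ Γ) bool → Tm (σ ∷ Γ) σ → Tm Γ σ
  query   : Tm Γ (list int) → Tm Γ int

⟦_⟧ : Ty → Set
⟦ int ⟧   = ℤ
⟦ bool ⟧  = Bool
⟦ list τ ⟧ = List ⟦ τ ⟧
⟦ σ ⊗ τ ⟧ = ⟦ σ ⟧ × ⟦ τ ⟧

Env : Ctx → Set
Env = All ⟦_⟧

-- Evaluation when the hidden vector is y.  `ρ ⊢ e ⇓ v [ t , s ]` says that in
-- the environment ρ the term e evaluates to v in t steps, making s queries.
-- The hidden vector enters only through the rule ⇓query, which returns
-- ‖x - y‖₁; there is no rule for a query outside {-k,…,k}ⁿ, so an algorithm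
-- that makes one has no value.
module Evaluation {n : ℕ} (k : ℕ) (y : Vec ℤ n) where

  infix 4 _⊢_⇓_[_,_] _⊢⟨_,_⟩_⟳_[_,_]

  private
    variable
      ρ                 : Env Γ
      t t₁ t₂ t₃ s s₁ s₂ s₃ : ℕ

  mutual
    data _⊢_⇓_[_,_] (ρ : Env Γ) : Tm Γ τ → ⟦ τ ⟧ → ℕ → ℕ → Set where

      ⇓var : (i : τ ∈ Γ) → ρ ⊢ var i ⇓ All.lookup ρ i [ 1 , 0 ]

      ⇓let : {e : Tm Γ σ} {e′ : Tm (σ ∷ Γ) τ} {v : ⟦ σ ⟧} {w : ⟦ τ ⟧} →
             ρ ⊢ e ⇓ v [ t₁ , s₁ ] → (v ∷ ρ) ⊢ e′ ⇓ w [ t₂ , s₂ ] →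
             ρ ⊢ let′ e e′ ⇓ w [ suc (t₁ + t₂) , s₁ + s₂ ]

      ⇓call : {f : Tm (σ ∷ []) τ} {e : Tm Γ σ} {v : ⟦ σ ⟧} {w : ⟦ τ ⟧} →
              ρ ⊢ e ⇓ v [ t₁ , s₁ ] → (v ∷ []) ⊢ f ⇓ w [ t₂ , s₂ ] →
              ρ ⊢ call f e ⇓ w [ suc (t₁ + t₂) , s₁ + s₂ ]

      ⇓lit : (a : ℤ) → ρ ⊢ lit a ⇓ a [ 1 , 0 ]

      ⇓add : {e e′ : Tm Γ int} {a b : ℤ} →
             ρ ⊢ e ⇓ a [ t₁ , s₁ ] → ρ ⊢ e′ ⇓ b [ t₂ , s₂ ] →
             ρ ⊢ add e e′ ⇓ a ℤ.+ b [ suc (t₁ + t₂) , s₁ + s₂ ]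

      ⇓sub : {e e′ : Tm Γ int} {a b : ℤ} →
             ρ ⊢ e ⇓ a [ t₁ , s₁ ] → ρ ⊢ e′ ⇓ b [ t₂ , s₂ ] →
             ρ ⊢ sub e e′ ⇓ a ℤ.- b [ suc (t₁ + t₂) , s₁ + s₂ ]

      ⇓leq : {e e′ : Tm Γ int} {a b : ℤ} →
             ρ ⊢ e ⇓ a [ t₁ , s₁ ] → ρ ⊢ e′ ⇓ b [ t₂ , s₂ ] →
             ρ ⊢ leq e e′ ⇓ a ℤ.≤ᵇ b [ suc (t₁ + t₂) , s₁ + s₂ ]

      ⇓if-true : {c : Tm Γ bool} {e e′ : Tm Γ τ} {v : ⟦ τ ⟧} →
                 ρ ⊢ c ⇓ true [ t₁ , s₁ ] → ρ ⊢ e ⇓ v [ t₂ , s₂ ] →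
                 ρ ⊢ if c e e′ ⇓ v [ suc (t₁ + t₂) , s₁ + s₂ ]

      ⇓if-false : {c : Tm Γ bool} {e e′ : Tm Γ τ} {v : ⟦ τ ⟧} →
                  ρ ⊢ c ⇓ false [ t₁ , s₁ ] → ρ ⊢ e′ ⇓ v [ t₂ , s₂ ] →
                  ρ ⊢ if c e e′ ⇓ v [ suc (t₁ + t₂) , s₁ + s₂ ]

      ⇓pair : {e : Tm Γ σ} {e′ : Tm Γ τ} {v : ⟦ σ ⟧} {w : ⟦ τ ⟧} →
              ρ ⊢ e ⇓ v [ t₁ , s₁ ] → ρ ⊢ e′ ⇓ w [ t₂ , s₂ ] →
              ρ ⊢ pair e e′ ⇓ (v , w) [ suc (t₁ + t₂) , s₁ + s₂ ]

      ⇓fst : {e : Tm Γ (σ ⊗ τ)} {v : ⟦ σ ⟧} {w : ⟦ τ ⟧} →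
             ρ ⊢ e ⇓ (v , w) [ t , s ] → ρ ⊢ fst e ⇓ v [ suc t , s ]

      ⇓snd : {e : Tm Γ (σ ⊗ τ)} {v : ⟦ σ ⟧} {w : ⟦ τ ⟧} →
             ρ ⊢ e ⇓ (v , w) [ t , s ] → ρ ⊢ snd e ⇓ w [ suc t , s ]

      ⇓nil : ρ ⊢ nil {τ = τ} ⇓ [] [ 1 , 0 ]

      ⇓cons : {e : Tm Γ τ} {e′ : Tm Γ (list τ)} {v : ⟦ τ ⟧} {vs : List ⟦ τ ⟧} →
              ρ ⊢ e ⇓ v [ t₁ , s₁ ] → ρ ⊢ e′ ⇓ vs [ t₂ , s₂ ] →
              ρ ⊢ cons e e′ ⇓ v ∷ vs [ suc (t₁ + t₂) , s₁ + s₂ ]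

      ⇓uncons-nil : {e : Tm Γ (list σ)} {e₁ : Tm Γ τ}
                    {e₂ : Tm (σ ∷ list σ ∷ Γ) τ} {w : ⟦ τ ⟧} →
                    ρ ⊢ e ⇓ [] [ t₁ , s₁ ] → ρ ⊢ e₁ ⇓ w [ t₂ , s₂ ] →
                    ρ ⊢ uncons e e₁ e₂ ⇓ w [ suc (t₁ + t₂) , s₁ + s₂ ]

      ⇓uncons-cons : {e : Tm Γ (list σ)} {e₁ : Tm Γ τ}
                     {e₂ : Tm (σ ∷ list σ ∷ Γ) τ}
                     {v : ⟦ σ ⟧} {vs : List ⟦ σ ⟧} {w : ⟦ τ ⟧} →
                     ρ ⊢ e ⇓ v ∷ vs [ t₁ , s₁ ] →
                     (v ∷ vs ∷ ρ) ⊢ e₂ ⇓ w [ t₂ , s₂ ] →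
                     ρ ⊢ uncons e e₁ e₂ ⇓ w [ suc (t₁ + t₂) , s₁ + s₂ ]

      ⇓while : {e₀ : Tm Γ σ} {c : Tm (σ ∷ Γ) bool} {b : Tm (σ ∷ Γ) σ}
               {v w : ⟦ σ ⟧} →
               ρ ⊢ e₀ ⇓ v [ t₁ , s₁ ] → ρ ⊢⟨ c , b ⟩ v ⟳ w [ t₂ , s₂ ] →
               ρ ⊢ while e₀ c b ⇓ w [ suc (t₁ + t₂) , s₁ + s₂ ]

      ⇓query : {e : Tm Γ (list int)} (x : Vec ℤ n) → InBox k x →
               ρ ⊢ e ⇓ Vec.toList x [ t , s ] →
               ρ ⊢ query e ⇓ + ‖ x -ᵥ y ‖₁ [ suc t , suc s ]

    -- The loop with test c and body b, entered in state v, is left in state w.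
    data _⊢⟨_,_⟩_⟳_[_,_] (ρ : Env Γ) (c : Tm (σ ∷ Γ) bool) (b : Tm (σ ∷ Γ) σ)
           : ⟦ σ ⟧ → ⟦ σ ⟧ → ℕ → ℕ → Set where

      ⟳stop : {v : ⟦ σ ⟧} → (v ∷ ρ) ⊢ c ⇓ false [ t , s ] →
              ρ ⊢⟨ c , b ⟩ v ⟳ v [ suc t , s ]

      ⟳step : {v v′ w : ⟦ σ ⟧} →
              (v ∷ ρ) ⊢ c ⇓ true [ t₁ , s₁ ] → (v ∷ ρ) ⊢ b ⇓ v′ [ t₂ , s₂ ] →
              ρ ⊢⟨ c , b ⟩ v′ ⟳ w [ t₃ , s₃ ] →
              ρ ⊢⟨ c , b ⟩ v ⟳ w [ suc (t₁ + t₂ + t₃) , s₁ + s₂ + s₃ ]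

-- One program serves all n and k, which it is given as input.
Algorithm : Set
Algorithm = Tm (int ∷ int ∷ []) (list int)

Recovers :
  ∀ {n} → Algorithm → ℕ → Vec ℤ n → ℕ → ℕ → Set
Recovers {n} P k y t s =
  (+ n ∷ + k ∷ []) ⊢ P ⇓ Vec.toList y [ t , s ]
  where open Evaluation k y

-- s ≤ C · min {n, n log k / log n} without real numbers: for n ≥ 2 and k ≥ 1,
-- s log n ≤ C n log k is n ^ s ≤ k ^ (C n).  At k = 1 the bound would be
-- s ≤ 0, which is impossible, so there log k is replaced by log 2.
QueryBound : ℕ → ℕ → ℕ → ℕ → Set
QueryBound C n k s = s ≤ C * n × n ^ s ≤ (2 ⊔ k) ^ (C * n)

{-# OPTIONS --safe #-}
module Submission where

-- For every coordinate keep an interval [lᵢ , lᵢ + w] that contains yᵢ, with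
-- the same w for all i, and halve all of them simultaneously.  Replacing xᵢ = m
-- by m + 1 changes ∣ xᵢ - yᵢ ∣ by -1 or +1 according to whether yᵢ > m, so that
-- a query between the midpoints and their successors counts the bits [yᵢ > mᵢ]
-- over a set of coordinates of our choice.  Such counts determine n bits from
-- O(n / log n) queries by the Cantor–Mills matrices: if M has m rows, the rows
-- (r , r , eᵢ) and (r , -r , 0) for the rows r of M form a matrix with 2m rows.
-- From a = Mu + Mv + w and b = Mu - Mv the parity of a + b = 2Mu + w gives the
-- bits w, then Mu and Mv follow.  There are O(log k) rounds of halving.  If
-- n ≤ k, the bound is of order n, and the unit vectors, with -k and k in place
-- of m and m + 1, give the coordinates in 2n queries.

-- In a query each coordinate has two values to choose from, m and m + 1, so one query realises a
-- row with entries 0 and 1, while the Cantor-Mills rows also have entries -1. A row r therefore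
-- costs two queries, one raised where r is 1 and one raised where r is -1; the unknown answer at
-- the unraised point cancels in their difference.
--
-- The language has no division. Numbers are halved by counting, in time linear in their absolute
-- value, and for this reason bounds on absolute values accompany the programs; the time may be
-- polynomial in k, which makes this affordable.
--
-- A matrix with 2^r rows has 2^(r-1) (r + 2) columns, which is the gain of a factor log n. One
-- round takes B queries with B log₂ n ≤ 16 n, and at most 3 log₂ (2 ⊔ k) rounds are charged, whence
-- 48 = 3 · 16. For k < n the number of rounds is also at most 3 log₂ n, which turns the same
-- estimate into the linear bound 48 n.

open import Defs
open import Data.Bool.Base using (Bool; true; false; if_then_else_; T)
open import Data.Empty using (⊥-elim)
open import Data.Integer.Base as ℤ using (ℤ; +_; -[1+_]; ∣_∣; 0ℤ; 1ℤ; -1ℤ; _⊖_)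
import Data.Integer.Properties as ℤ
open import Data.Integer.Tactic.RingSolver using (solve-∀)
open import Data.List.Base using (List; []; _∷_; _++_; _ʳ++_; reverse; foldr; map; zip; length; replicate)
open import Data.List.Properties
  using (reverse-involutive; length-reverse; ++-is-foldr; map-is-foldr; ʳ++-defn; length-++;
         length-map; length-replicate; ++-assoc; ++-identityʳ; map-∘; map-cong)
open import Data.List.Membership.Propositional using (_∈_)
open import Data.List.Relation.Binary.Pointwise using (Pointwise; []; _∷_)
open import Data.List.Relation.Unary.All as All using (All; []; _∷_)
import Data.List.Relation.Unary.All.Properties as All
open import Data.List.Relation.Unary.Any using (here; there)
open import Data.Nat.Base
  using (ℕ; zero; suc; _+_; _*_; _∸_; _^_; _≤_; _<_; z≤n; s≤s; _⊔_; ⌊_/2⌋; ⌈_/2⌉; >-nonZero)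
open import Data.Nat.Properties
import Data.Nat.Tactic.RingSolver as ℕ
open import Data.Product.Base using (_×_; _,_; Σ-syntax; proj₁; proj₂)
open import Data.Sum.Base using (inj₁; inj₂)
open import Data.Unit.Base using (⊤; tt)
open import Data.Vec.Base as Vec using (Vec)
import Data.Vec.Properties as Vec
import Data.Vec.Relation.Unary.All as VecAll
open import Relation.Binary.PropositionalEquality
open import Relation.Nullary.Decidable.Core using (Dec; yes; no)
open import Relation.Nullary.Negation.Core using (contradiction)

private
  variable
    Γ : Ctx
    σ τ α : Ty


-- Evaluation with bounded cost

-- Running times are bounded by the values of polynomials kept as syntax.  In
-- Σ[ p ∈ Poly ] (∀ {W} … → Runs W … p …) the polynomial cannot depend on the
-- sizes n and k or on the hidden vector, so the bound is uniform in them.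
data Poly : Set where
  con       : ℕ → Poly
  X         : Poly
  _:+_ _:*_ : Poly → Poly → Poly

infixl 6 _:+_
infixl 7 _:*_

eval : Poly → ℕ → ℕ
eval (con c)  b = c
eval X        b = b
eval (p :+ q) b = eval p b + eval q b
eval (p :* q) b = eval p b * eval q b

after : Poly → Poly → Poly
after p q = con 1 :+ (p :+ q)

-- `size` is the argument of the polynomials that bound running times.
record World : Set where
  constructor world
  field
    {dim}  : ℕ
    box    : ℕ
    hidden : Vec ℤ dim
    size   : ℕ
open World

module _ (W : World) where
  open Evaluation (box W) (hidden W)

  record Runs {Γ} {τ} (ρ : Env Γ) (e : Tm Γ τ) (v : ⟦ τ ⟧) (p : Poly) (S : ℕ) : Set where
    constructor runs
    field
      {time queries} : ℕ
      derivation     : ρ ⊢ e ⇓ v [ time , queries ]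
      time≤          : time ≤ eval p (size W)
      queries≤       : queries ≤ S

  -- A loop of `m` rounds performs `suc m` tests. Charging the last test as a full round keeps the
  -- time a product, which `while-runs` turns into a polynomial once `m` has a polynomial bound.
  record Loops {Γ} {σ} (ρ : Env Γ) (c : Tm (σ ∷ Γ) bool) (e : Tm (σ ∷ Γ) σ) (p q : Poly)
               (v w : ⟦ σ ⟧) (m S : ℕ) : Set where
    constructor loops
    field
      {time queries} : ℕ
      derivation     : ρ ⊢⟨ c , e ⟩ v ⟳ w [ time , queries ]
      time≤          : time ≤ suc m * eval (after p q) (size W)
      queries≤       : queries ≤ S

private
  variable
    W : World
    ρ : Env Γ
    p q r : Poly
    S S₁ S₂ m m₁ m₂ : ℕ

module _ {W : World} where
  open Evaluation (box W) (hidden W)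

  var-runs : (i : τ ∈ Γ) → Runs W ρ (var i) (All.lookup ρ i) (con 1) 0
  var-runs i = runs (⇓var i) ≤-refl ≤-refl

  let-runs : {e : Tm Γ σ} {e′ : Tm (σ ∷ Γ) τ} {v : ⟦ σ ⟧} {w : ⟦ τ ⟧} →
             Runs W ρ e v p S₁ → Runs W (v ∷ ρ) e′ w q S₂ →
             Runs W ρ (let′ e e′) w (after p q) (S₁ + S₂)
  let-runs (runs d t s) (runs d′ t′ s′) = runs (⇓let d d′) (s≤s (+-mono-≤ t t′)) (+-mono-≤ s s′)

  call-runs : {f : Tm (σ ∷ []) τ} {e : Tm Γ σ} {v : ⟦ σ ⟧} {w : ⟦ τ ⟧} →
              Runs W ρ e v p S₁ → Runs W (v ∷ []) f w q S₂ →
              Runs W ρ (call f e) w (after p q) (S₁ + S₂)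
  call-runs (runs d t s) (runs d′ t′ s′) = runs (⇓call d d′) (s≤s (+-mono-≤ t t′)) (+-mono-≤ s s′)

  lit-runs : (a : ℤ) → Runs W ρ (lit a) a (con 1) 0
  lit-runs a = runs (⇓lit a) ≤-refl ≤-refl

  add-runs : {e e′ : Tm Γ int} {a b : ℤ} → Runs W ρ e a p S₁ → Runs W ρ e′ b q S₂ →
             Runs W ρ (add e e′) (a ℤ.+ b) (after p q) (S₁ + S₂)
  add-runs (runs d t s) (runs d′ t′ s′) = runs (⇓add d d′) (s≤s (+-mono-≤ t t′)) (+-mono-≤ s s′)

  sub-runs : {e e′ : Tm Γ int} {a b : ℤ} → Runs W ρ e a p S₁ → Runs W ρ e′ b q S₂ →
             Runs W ρ (sub e e′) (a ℤ.- b) (after p q) (S₁ + S₂)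
  sub-runs (runs d t s) (runs d′ t′ s′) = runs (⇓sub d d′) (s≤s (+-mono-≤ t t′)) (+-mono-≤ s s′)

  leq-runs : {e e′ : Tm Γ int} {a b : ℤ} → Runs W ρ e a p S₁ → Runs W ρ e′ b q S₂ →
             Runs W ρ (leq e e′) (a ℤ.≤ᵇ b) (after p q) (S₁ + S₂)
  leq-runs (runs d t s) (runs d′ t′ s′) = runs (⇓leq d d′) (s≤s (+-mono-≤ t t′)) (+-mono-≤ s s′)

  pair-runs : {e : Tm Γ σ} {e′ : Tm Γ τ} {v : ⟦ σ ⟧} {w : ⟦ τ ⟧} →
              Runs W ρ e v p S₁ → Runs W ρ e′ w q S₂ →
              Runs W ρ (pair e e′) (v , w) (after p q) (S₁ + S₂)
  pair-runs (runs d t s) (runs d′ t′ s′) = runs (⇓pair d d′) (s≤s (+-mono-≤ t t′)) (+-mono-≤ s s′)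

  fst-runs : {e : Tm Γ (σ ⊗ τ)} {v : ⟦ σ ⟧} {w : ⟦ τ ⟧} → Runs W ρ e (v , w) p S →
             Runs W ρ (fst e) v (con 1 :+ p) S
  fst-runs (runs d t s) = runs (⇓fst d) (s≤s t) s

  snd-runs : {e : Tm Γ (σ ⊗ τ)} {v : ⟦ σ ⟧} {w : ⟦ τ ⟧} → Runs W ρ e (v , w) p S →
             Runs W ρ (snd e) w (con 1 :+ p) S
  snd-runs (runs d t s) = runs (⇓snd d) (s≤s t) s

  nil-runs : Runs W ρ (nil {τ = τ}) [] (con 1) 0
  nil-runs = runs ⇓nil ≤-refl ≤-refl

  cons-runs : {e : Tm Γ τ} {e′ : Tm Γ (list τ)} {v : ⟦ τ ⟧} {vs : List ⟦ τ ⟧} →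
              Runs W ρ e v p S₁ → Runs W ρ e′ vs q S₂ →
              Runs W ρ (cons e e′) (v ∷ vs) (after p q) (S₁ + S₂)
  cons-runs (runs d t s) (runs d′ t′ s′) = runs (⇓cons d d′) (s≤s (+-mono-≤ t t′)) (+-mono-≤ s s′)

  -- Polynomials have no maximum, so the costs of the two branches are added. Each branch may assume
  -- the outcome of the test, which is how facts about the data reach the proof from the program.
  if-runs : {c : Tm Γ bool} {e e′ : Tm Γ τ} {b : Bool} {v : ⟦ τ ⟧} → Runs W ρ c b p S₁ →
            (b ≡ true → Runs W ρ e v q S₂) → (b ≡ false → Runs W ρ e′ v r S₂) →
            Runs W ρ (if c e e′) v (after p (q :+ r)) (S₁ + S₂)
  if-runs {b = true} (runs d t s) on off with on refl
  ... | runs d′ t′ s′ = runs (⇓if-true d d′) (s≤s (+-mono-≤ t (≤-trans t′ (m≤m+n _ _))))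
                          (+-mono-≤ s s′)
  if-runs {b = false} (runs d t s) on off with off refl
  ... | runs d′ t′ s′ = runs (⇓if-false d d′) (s≤s (+-mono-≤ t (≤-trans t′ (m≤n+m _ _))))
                          (+-mono-≤ s s′)

  uncons-runs : {e : Tm Γ (list σ)} {e₁ : Tm Γ τ} {e₂ : Tm (σ ∷ list σ ∷ Γ) τ}
                {vs : List ⟦ σ ⟧} {w : ⟦ τ ⟧} → Runs W ρ e vs p S₁ →
                (vs ≡ [] → Runs W ρ e₁ w q S₂) →
                (∀ x xs → vs ≡ x ∷ xs → Runs W (x ∷ xs ∷ ρ) e₂ w r S₂) →
                Runs W ρ (uncons e e₁ e₂) w (after p (q :+ r)) (S₁ + S₂)
  uncons-runs {vs = []} (runs d t s) empty more with empty refl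
  ... | runs d′ t′ s′ = runs (⇓uncons-nil d d′) (s≤s (+-mono-≤ t (≤-trans t′ (m≤m+n _ _))))
                          (+-mono-≤ s s′)
  uncons-runs {vs = x ∷ xs} (runs d t s) empty more with more x xs refl
  ... | runs d′ t′ s′ = runs (⇓uncons-cons d d′) (s≤s (+-mono-≤ t (≤-trans t′ (m≤n+m _ _))))
                          (+-mono-≤ s s′)

  weaken-queries : {e : Tm Γ τ} {v : ⟦ τ ⟧} → S₁ ≤ S₂ → Runs W ρ e v p S₁ → Runs W ρ e v p S₂
  weaken-queries S≤ (runs d t s) = runs d t (≤-trans s S≤)

  value : {e : Tm Γ τ} {v w : ⟦ τ ⟧} → v ≡ w → Runs W ρ e v p S → Runs W ρ e w p S
  value refl R = R

  module _ {c : Tm (σ ∷ Γ) bool} {e : Tm (σ ∷ Γ) σ} where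

    stop : {v : ⟦ σ ⟧} → Runs W (v ∷ ρ) c false p 0 → Loops W ρ c e p q v v 0 0
    stop {p = p} {q = q} (runs d t s) =
      loops (⟳stop d) (≤-trans (s≤s (≤-trans t (m≤m+n _ (eval q (size W))))) (m≤m+n _ 0)) s

    step : {v v′ w : ⟦ σ ⟧} → Runs W (v ∷ ρ) c true p 0 → Runs W (v ∷ ρ) e v′ q S₁ →
           Loops W ρ c e p q v′ w m S₂ → Loops W ρ c e p q v w (suc m) (S₁ + S₂)
    step (runs {queries = s₀} d t s) (runs d′ t′ s′) (loops d″ t″ s″) =
      loops (⟳step d d′ d″) (s≤s (+-mono-≤ (+-mono-≤ t t′) t″))
        (+-mono-≤ (+-mono-≤ s s′) s″)

    weaken-rounds : {v w : ⟦ σ ⟧} → m₁ ≤ m₂ → Loops W ρ c e p q v w m₁ S →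
                    Loops W ρ c e p q v w m₂ S
    weaken-rounds {p = p} {q = q} m≤ (loops d t s) =
      loops d (≤-trans t (*-monoˡ-≤ (eval (after p q) (size W)) (s≤s m≤))) s

  while-runs : {e₀ : Tm Γ σ} {c : Tm (σ ∷ Γ) bool} {e : Tm (σ ∷ Γ) σ} {v w : ⟦ σ ⟧} →
               Runs W ρ e₀ v r S₁ → ∀ μ → m ≤ eval μ (size W) → Loops W ρ c e p q v w m S₂ →
               Runs W ρ (while e₀ c e) w (after r ((con 1 :+ μ) :* after p q)) (S₁ + S₂)
  while-runs {p = p} {q = q} (runs d t s) μ m≤ (loops d′ t′ s′) =
    runs (⇓while d d′)
      (s≤s (+-mono-≤ t (≤-trans t′ (*-monoˡ-≤ (eval (after p q) (size W)) (s≤s m≤)))))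
      (+-mono-≤ s s′)

-- Variables, Boolean constants and loops over a list

v₀ : Tm (σ ∷ Γ) σ
v₀ = var (here refl)
v₁ : ∀ {a} → Tm (a ∷ σ ∷ Γ) σ
v₁ = var (there (here refl))
v₂ : ∀ {a b} → Tm (a ∷ b ∷ σ ∷ Γ) σ
v₂ = var (there (there (here refl)))
v₃ : ∀ {a b c} → Tm (a ∷ b ∷ c ∷ σ ∷ Γ) σ
v₃ = var (there (there (there (here refl))))
v₄ : ∀ {a b c d} → Tm (a ∷ b ∷ c ∷ d ∷ σ ∷ Γ) σ
v₄ = var (there (there (there (there (here refl)))))
v₅ : ∀ {a b c d e} → Tm (a ∷ b ∷ c ∷ d ∷ e ∷ σ ∷ Γ) σ
v₅ = var (there (there (there (there (there (here refl))))))

-- Comparisons are the only source of Booleans in the language.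
true′ false′ : Tm Γ bool
true′  = leq (lit 0ℤ) (lit 0ℤ)
false′ = leq (lit 1ℤ) (lit 0ℤ)

true-runs : Runs W ρ true′ true (con 3) 0
true-runs = runs (Evaluation.⇓leq (Evaluation.⇓lit _) (Evaluation.⇓lit _)) ≤-refl ≤-refl

false-runs : Runs W ρ false′ false (con 3) 0
false-runs = runs (Evaluation.⇓leq (Evaluation.⇓lit _) (Evaluation.⇓lit _)) ≤-refl ≤-refl

-- The body sees the accumulator, the current element, the remaining elements
-- and the state of the loop, in this order, before the variables of Γ.
Body : Ctx → Ty → Ty → Set
Body Γ σ α = Tm (α ∷ σ ∷ list σ ∷ (list σ ⊗ α) ∷ Γ) α

forEach : Tm Γ (list σ) → Tm Γ α → Body Γ σ α → Tm Γ α
forEach xs a body =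
  snd (while (pair xs a) (uncons (fst v₀) false′ true′)
    -- The test excludes the empty list, so the first branch, which returns the state unchanged, is
    -- never taken.
    (uncons (fst v₀) v₀ (pair v₁ (let′ (snd v₂) body))))

-- The invariant relates the elements still to come to the accumulator. The final value is
-- existential because an invariant need not determine the intermediate accumulators; what is known
-- of the result is `I [] b`.
forEach-runs :
  Σ[ c ∈ (Poly → Poly → Poly → Poly) ] (∀ {W Γ σ α p q r S₁ S₂ S₃} {ρ : Env Γ}
    {exs : Tm Γ (list σ)} {e : Tm Γ α} {body : Body Γ σ α} {xs a}
    (I : List ⟦ σ ⟧ → ⟦ α ⟧ → Set) →
    Runs W ρ exs xs p S₁ → length xs ≤ size W → Runs W ρ e a q S₂ → I xs a →
    (∀ x us a → I (x ∷ us) a →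
      Σ[ a′ ∈ ⟦ α ⟧ ] I us a′ × Runs W (a ∷ x ∷ us ∷ (x ∷ us , a) ∷ ρ) body a′ r S₃) →
    Σ[ b ∈ ⟦ α ⟧ ] I [] b × Runs W ρ (forEach exs e body) b (c p q r) (S₁ + S₂ + length xs * S₃))
forEach-runs = _ , λ {W} I xs-runs len e-runs init body-runs →
  let (w , Iw , L) = loop I body-runs _ _ init
  in  w , Iw , (snd-runs (while-runs (pair-runs xs-runs e-runs) X len L))
  where
  loop : ∀ {W Γ σ α r S} {ρ : Env Γ} {body : Body Γ σ α} (I : List ⟦ σ ⟧ → ⟦ α ⟧ → Set) →
    (∀ x us a → I (x ∷ us) a →
      Σ[ a′ ∈ ⟦ α ⟧ ] I us a′ × Runs W (a ∷ x ∷ us ∷ (x ∷ us , a) ∷ ρ) body a′ r S) →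
    ∀ xs a → I xs a →
    Σ[ b ∈ ⟦ α ⟧ ] I [] b ×
      Loops W ρ (uncons (fst v₀) false′ true′)
        (uncons (fst v₀) v₀ (pair v₁ (let′ (snd v₂) body)))
        (after (con 1 :+ con 1) (con 3 :+ con 3)) (after (con 1 :+ con 1) (con 1 :+ after (con 1) (after (con 1 :+ con 1) r)))
        (xs , a) ([] , b) (length xs) (length xs * S)
  loop I body-runs [] a Ia =
    a , Ia , stop (uncons-runs (fst-runs (var-runs _)) (λ _ → false-runs) λ _ _ ())
  loop I body-runs (x ∷ xs) a Ia with body-runs x xs a Ia
  ... | a′ , Ia′ , R with loop I body-runs xs a′ Ia′
  ...   | b , Ib , L = b , Ib ,
    step (uncons-runs (fst-runs (var-runs _)) (λ ()) λ { _ _ refl → true-runs })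
      (uncons-runs (fst-runs (var-runs _)) (λ ()) λ { _ _ refl →
         pair-runs (var-runs _) (let-runs (snd-runs (var-runs _)) R) })
      L

-- Procedures on lists

no-queries : ∀ m {e : Tm Γ τ} {v : ⟦ τ ⟧} → Runs W ρ e v p (m * 0) → Runs W ρ e v p 0
no-queries m = weaken-queries (≤-reflexive (*-zeroʳ m))

rev : Tm (list τ ∷ []) (list τ)
rev = forEach v₀ nil (cons v₁ v₀)

rev-runs : Σ[ p ∈ Poly ] (∀ {W τ} (xs : List ⟦ τ ⟧) → length xs ≤ size W →
  Runs W (xs ∷ []) (rev {τ}) (reverse xs) p 0)
rev-runs = _ , λ xs len → 
  let (ys , eq , R) = proj₂ forEach-runs (λ us acc → us ʳ++ acc ≡ reverse xs)
        (var-runs _) len nil-runs refl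
        (λ x us acc inv → x ∷ acc , inv , cons-runs (var-runs _) (var-runs _))
  in  value eq (no-queries (length xs) R)

foldR : Tm Γ (list σ) → Tm Γ α → Body Γ σ α → Tm Γ α
foldR xs e body = forEach (call rev xs) e body

-- The loop runs over the reversed list; its invariant splits `xs` into the part `vs` still to come,
-- in reverse, and the suffix `us` already folded. The body may assume that this suffix is shorter
-- than `xs`, which bounds accumulators that grow with it, as in `units`.
foldR-runs :
  Σ[ c ∈ (Poly → Poly → Poly → Poly) ] (∀ {W Γ σ α p q r S₁ S₂ S₃} {ρ : Env Γ}
    {exs : Tm Γ (list σ)} {e : Tm Γ α} {body : Body Γ σ α} {xs a}
    (f : ⟦ σ ⟧ → ⟦ α ⟧ → ⟦ α ⟧) {P : ⟦ σ ⟧ → Set} →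
    Runs W ρ exs xs p S₁ → length xs ≤ size W → Runs W ρ e a q S₂ → All P xs →
    (∀ x us vs → All P (x ∷ us) → length us < length xs →
      Runs W (foldr f a us ∷ x ∷ vs ∷ (x ∷ vs , foldr f a us) ∷ ρ) body (f x (foldr f a us)) r S₃) →
    Runs W ρ (foldR exs e body) (foldr f a xs) (c p q r) (S₁ + S₂ + length xs * S₃))
foldR-runs = _ , λ {W} {S₁ = S₁} {S₂ = S₂} {S₃ = S₃} {xs = xs} {a = a} f {P} xs-runs len e-runs Pxs body-runs →

  let (b , (us , split , eq) , R) = proj₂ forEach-runs (λ vs b → Σ[ us ∈ List _ ] vs ʳ++ us ≡ xs × b ≡ foldr f a us)
        (call-runs xs-runs (proj₂ rev-runs xs len))
        (subst (_≤ size W) (sym (length-reverse xs)) len)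
        e-runs ([] , reverse-involutive xs , refl)
        (λ { x vs _ (us , split , refl) → f x (foldr f a us) , (x ∷ us , split , refl) ,
               body-runs x us vs (Pmid vs split Pxs) (shorter vs split) })
  in  value (trans eq (cong (foldr f a) split))
        (weaken-queries
          (≤-reflexive (cong₂ (λ s l → s + S₂ + l * S₃) (+-identityʳ S₁) (length-reverse xs))) R)
  where
  mid : ∀ {A : Set} {xs : List A} {x us} vs → vs ʳ++ x ∷ us ≡ xs → xs ≡ reverse vs ++ x ∷ us
  mid vs split = trans (sym split) (ʳ++-defn vs)
  Pmid : ∀ {A : Set} {P : A → Set} {xs x us} vs → vs ʳ++ x ∷ us ≡ xs → All P xs → All P (x ∷ us)
  Pmid {P = P} vs split Pxs = All.++⁻ʳ (reverse vs) (subst (All P) (mid vs split) Pxs)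
  shorter : ∀ {A : Set} {xs : List A} {x us} vs → vs ʳ++ x ∷ us ≡ xs → length us < length xs
  shorter {x = x} {us} vs split =
    subst (length us <_) (sym (trans (cong length (mid vs split)) (length-++ (reverse vs))))
      (m≤n+m (suc (length us)) (length (reverse vs)))

mapL : Tm Γ (list σ) → Tm (list τ ∷ σ ∷ list σ ∷ (list σ ⊗ list τ) ∷ Γ) τ → Tm Γ (list τ)
mapL xs e = foldR xs nil (cons e v₀)

mapL-runs :
  Σ[ c ∈ (Poly → Poly → Poly) ] (∀ {W Γ σ τ p q S₁ S₂} {ρ : Env Γ}
    {exs : Tm Γ (list σ)} {e : Tm (list τ ∷ σ ∷ list σ ∷ (list σ ⊗ list τ) ∷ Γ) τ} {xs}
    (f : ⟦ σ ⟧ → ⟦ τ ⟧) {P : ⟦ σ ⟧ → Set} →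
    Runs W ρ exs xs p S₁ → length xs ≤ size W → All P xs →
    (∀ x us vs → P x → Runs W (us ∷ x ∷ vs ∷ (x ∷ vs , us) ∷ ρ) e (f x) q S₂) →
    Runs W ρ (mapL exs e) (map f xs) (c p q) (S₁ + length xs * S₂))
mapL-runs = _ , λ {S₁ = S₁} {S₂ = S₂} {xs = xs} f xs-runs len Pxs e-runs →
  value (sym (map-is-foldr xs))
  (weaken-queries (≤-reflexive (cong₂ (λ s s′ → s + length xs * s′) (+-identityʳ S₁) (+-identityʳ S₂)))
    (proj₂ foldR-runs (λ x us → f x ∷ us) xs-runs len nil-runs Pxs
      (λ x us vs Pxs _ → cons-runs (e-runs x _ vs (All.head Pxs)) (var-runs _))))

always : ∀ {A : Set} (xs : List A) → All (λ _ → ⊤) xs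
always = All.universal (λ _ → tt)

append : Tm (list τ ⊗ list τ ∷ []) (list τ)
append = foldR (fst v₀) (snd v₀) (cons v₁ v₀)

append-runs : Σ[ p ∈ Poly ] (∀ {W τ} (xs ys : List ⟦ τ ⟧) → length xs ≤ size W →
  Runs W ((xs , ys) ∷ []) (append {τ}) (xs ++ ys) p 0)
append-runs = _ , λ xs ys len → value (sym (++-is-foldr xs ys))
  (no-queries (length xs) (proj₂ foldR-runs _∷_ (fst-runs (var-runs _)) len (snd-runs (var-runs _)) (always xs)
    (λ _ _ _ _ _ → cons-runs (var-runs _) (var-runs _))))

zipL : Tm (list σ ⊗ list τ ∷ []) (list (σ ⊗ τ))
zipL = call rev (snd (forEach (fst v₀) (pair (snd v₀) nil)
  (uncons (fst v₀) v₀ (pair v₁ (cons (pair v₃ v₀) (snd v₂))))))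

zip-[] : ∀ {A B : Set} (xs : List A) → zip {B = B} xs [] ≡ []
zip-[] []       = refl
zip-[] (x ∷ xs) = refl

zip-≤ : ∀ {A B : Set} (xs : List A) (ys : List B) → length (zip xs ys) ≤ length xs
zip-≤ []       ys       = z≤n
zip-≤ (x ∷ xs) []       = z≤n
zip-≤ (x ∷ xs) (y ∷ ys) = s≤s (zip-≤ xs ys)

zip-runs : Σ[ p ∈ Poly ] (∀ {W σ τ} (xs : List ⟦ σ ⟧) (ys : List ⟦ τ ⟧) → length xs ≤ size W →
  Runs W ((xs , ys) ∷ []) (zipL {σ} {τ}) (zip xs ys) p 0)
zip-runs = _ , λ {W} {σ} {τ} xs ys len →
  let (b , eq , R) = proj₂ forEach-runs
        (λ us (ys′ , out) → out ʳ++ zip us ys′ ≡ zip xs ys)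
        (fst-runs (var-runs _)) len (pair-runs (snd-runs (var-runs _)) nil-runs) refl
        (λ { x us ([] , out) inv → ([] , out) , subst (λ l → out ʳ++ l ≡ zip xs ys) (sym (zip-[] us)) inv ,
               uncons-runs (fst-runs (var-runs _)) (λ _ → var-runs _) λ _ _ ()
           ; x us (y ∷ ys′ , out) inv → (ys′ , (x , y) ∷ out) , inv ,
               uncons-runs (fst-runs (var-runs _)) (λ ())
                 λ { _ _ refl → pair-runs (var-runs _)
                      (cons-runs (pair-runs (var-runs _) (var-runs _)) (snd-runs (var-runs _))) } })
  in  value eq (call-runs (no-queries (length xs) (snd-runs R)) (proj₂ rev-runs (proj₂ b)
        (≤-trans (≤-trans (≤-reflexive (trans (sym (length-reverse (proj₂ b))) (cong length eq)))
          (zip-≤ xs ys)) len)))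

-- Halving

data Bit : ℤ → Set where
  bit0 : Bit 0ℤ
  bit1 : Bit 1ℤ

bit-≤ : ∀ {c} → Bit c → ∣ c ∣ ≤ 1
bit-≤ bit0 = z≤n
bit-≤ bit1 = ≤-refl

-- Rounds towards minus infinity, so that the remainder is a bit for negative numbers too. The
-- decoding needs this, since entries of codewords can have either sign.
halve : ℤ → ℤ
halve (+ n)    = + ⌊ n /2⌋
halve -[1+ n ] = -[1+ ⌊ n /2⌋ ]

halve-double : ∀ q {w} → Bit w → halve (q ℤ.+ q ℤ.+ w) ≡ q
halve-double (+ m)    bit0 = cong +_ (trans (cong ⌊_/2⌋ (+-identityʳ (m + m))) (sym (n≡⌊n+n/2⌋ m)))
halve-double (+ m)    bit1 = cong +_ (trans (cong ⌊_/2⌋ (+-comm (m + m) 1)) (sym (n≡⌈n+n/2⌉ m)))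
halve-double -[1+ m ] bit0 = cong -[1+_] (sym (n≡⌈n+n/2⌉ m))
halve-double -[1+ m ] bit1 = cong -[1+_] (sym (n≡⌊n+n/2⌋ m))

halving : ∀ z → Σ[ w ∈ ℤ ] Bit w × z ≡ halve z ℤ.+ halve z ℤ.+ w
halving (+ n) = half-ℕ n
  where
  half-ℕ : ∀ n → Σ[ w ∈ ℤ ] Bit w × + n ≡ + (⌊ n /2⌋ + ⌊ n /2⌋) ℤ.+ w
  half-ℕ 0 = 0ℤ , bit0 , refl
  half-ℕ 1 = 1ℤ , bit1 , refl
  half-ℕ (suc (suc n)) with half-ℕ n
  ... | w , b , eq = w , b ,
    trans (cong (λ j → + 2 ℤ.+ j) eq) (trans (sym (ℤ.+-assoc (+ 2) (+ (⌊ n /2⌋ + ⌊ n /2⌋)) w))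
      (cong (λ l → + suc l ℤ.+ w) (sym (+-suc ⌊ n /2⌋ ⌊ n /2⌋))))
-- With n = 2h + w one has -(1 + n) = 2 (-1 - h) + (1 - w): the bit is complemented.
halving -[1+ n ] with halving (+ n)
... | _ , bit0 , eq = 1ℤ , bit1 , cong -[1+_] (ℤ.+-injective (trans eq (ℤ.+-identityʳ _)))
... | _ , bit1 , eq = 0ℤ , bit0 , cong -[1+_] (ℤ.+-injective (trans eq (ℤ.+-comm (+ (⌊ n /2⌋ + ⌊ n /2⌋)) 1ℤ)))

≤⇒≤ᵇ-true : ∀ {i j} → i ℤ.≤ j → (i ℤ.≤ᵇ j) ≡ true
≤⇒≤ᵇ-true {i} {j} i≤j with i ℤ.≤ᵇ j | ℤ.≤⇒≤ᵇ i≤j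
... | true | _ = refl

<⇒≤ᵇ-false : ∀ {i j} → j ℤ.< i → (i ℤ.≤ᵇ j) ≡ false
<⇒≤ᵇ-false {i} {j} j<i with i ℤ.≤ᵇ j in eq
... | false = refl
... | true  = ⊥-elim (ℤ.<⇒≱ j<i (ℤ.≤ᵇ⇒≤ (subst T (sym eq) _)))

-- Counts upwards while 2 (h + 1) ≤ z. The start is 0, or z itself for negative z, which is then at
-- most its own half; either way the number of rounds is at most the absolute value of z.
half : Tm (int ∷ []) int
half = while (if (leq (lit 0ℤ) v₀) (lit 0ℤ) v₀)
  (leq (add (add v₀ v₀) (lit (+ 2))) v₁) (add v₀ (lit 1ℤ))

half-runs : Σ[ p ∈ Poly ] (∀ {W} z → ∣ z ∣ ≤ size W → Runs W (z ∷ []) half (halve z) p 0)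
half-runs = _ , λ z small →
  while-runs (if-runs {v = start z} (leq-runs (lit-runs _) (var-runs _))
      (λ eq → value (start-true z eq) (lit-runs _)) (λ eq → value (start-false z eq) (var-runs _)))
    X (≤-trans (distance-≤ z) small) (loop z (distance z) (start z) (start-correct z))
  where
  start : ℤ → ℤ
  start (+ n)    = 0ℤ
  start -[1+ n ] = -[1+ n ]
  start-true : ∀ z → (0ℤ ℤ.≤ᵇ z) ≡ true → 0ℤ ≡ start z
  start-true (+ n) _ = refl
  start-false : ∀ z → (0ℤ ℤ.≤ᵇ z) ≡ false → z ≡ start z
  start-false -[1+ n ] _ = refl
  distance : ℤ → ℕ
  distance (+ n)    = ⌊ n /2⌋
  distance -[1+ n ] = ⌈ n /2⌉
  distance-≤ : ∀ z → distance z ≤ ∣ z ∣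
  distance-≤ (+ n)    = ⌊n/2⌋≤n n
  distance-≤ -[1+ n ] = m≤n⇒m≤1+n (⌈n/2⌉≤n n)
  start-correct : ∀ z → start z ℤ.+ + distance z ≡ halve z
  start-correct (+ n)    = refl
  start-correct -[1+ n ] = begin
    -[1+ n ] ℤ.+ + d                        ≡⟨ cong (λ l → -[1+ l ] ℤ.+ + d) (⌊n/2⌋+⌈n/2⌉≡n n) ⟨
    ℤ.- (+ suc h ℤ.+ + d) ℤ.+ + d           ≡⟨ cancel (+ suc h) (+ d) ⟩
    -[1+ h ]                                ∎
    where
    open ≡-Reasoning
    h = ⌊ n /2⌋
    d = ⌈ n /2⌉
    cancel : ∀ a b → ℤ.- (a ℤ.+ b) ℤ.+ b ≡ ℤ.- a
    cancel = solve-∀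
  loop : ∀ {W} z i h → h ℤ.+ + i ≡ halve z →
         Loops W (z ∷ []) (leq (add (add v₀ v₀) (lit (+ 2))) v₁) (add v₀ (lit 1ℤ)) _ _ h (halve z) i 0
  loop z zero h eq with trans (sym (ℤ.+-identityʳ h)) eq
  ... | refl = stop (value (<⇒≤ᵇ-false below)
                 (leq-runs (add-runs (add-runs (var-runs _) (var-runs _)) (lit-runs _)) (var-runs _)))
    where
    ĥ = halve z
    below : z ℤ.< ĥ ℤ.+ ĥ ℤ.+ + 2
    below with halving z
    ... | w , b , z≡ = subst (ℤ._< ĥ ℤ.+ ĥ ℤ.+ + 2) (sym z≡) (ℤ.+-monoʳ-< (ĥ ℤ.+ ĥ) (bit<2 b))
      where
      bit<2 : ∀ {w} → Bit w → w ℤ.< + 2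
      bit<2 bit0 = ℤ.+<+ (s≤s z≤n)
      bit<2 bit1 = ℤ.+<+ (s≤s (s≤s z≤n))
  loop z (suc i) h eq =
    step (value (≤⇒≤ᵇ-true above)
        (leq-runs (add-runs (add-runs (var-runs _) (var-runs _)) (lit-runs _)) (var-runs _)))
      (add-runs (var-runs _) (lit-runs _))
      (loop z i (h ℤ.+ 1ℤ) (trans (ℤ.+-assoc h 1ℤ (+ i)) eq))
    where
    ĥ = halve z
    above : h ℤ.+ h ℤ.+ + 2 ℤ.≤ z
    above with halving z
    ... | w , b , z≡ = begin
      h ℤ.+ h ℤ.+ + 2                               ≤⟨ ℤ.i≤i+j _ (+ i ℤ.+ + i ℤ.+ w) {{nonneg b}} ⟩
      h ℤ.+ h ℤ.+ + 2 ℤ.+ (+ i ℤ.+ + i ℤ.+ w)       ≡⟨ regroup h (+ i) w ⟩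
      h ℤ.+ + suc i ℤ.+ (h ℤ.+ + suc i) ℤ.+ w       ≡⟨ cong (λ j → j ℤ.+ j ℤ.+ w) eq ⟩
      ĥ ℤ.+ ĥ ℤ.+ w                                 ≡⟨ z≡ ⟨
      z                                             ∎
      where
      open ℤ.≤-Reasoning
      nonneg : ∀ {w} → Bit w → ℤ.NonNegative (+ i ℤ.+ + i ℤ.+ w)
      nonneg bit0 = _
      nonneg bit1 = _
      regroup : ∀ h i w → h ℤ.+ h ℤ.+ + 2 ℤ.+ (i ℤ.+ i ℤ.+ w) ≡
                h ℤ.+ (1ℤ ℤ.+ i) ℤ.+ (h ℤ.+ (1ℤ ℤ.+ i)) ℤ.+ w
      regroup = solve-∀

-- Queries

target : World → List ℤ
target W = Vec.toList (hidden W)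

distance : List ℤ → List ℤ → ℕ
distance (x ∷ xs) (y ∷ ys) = ∣ x ℤ.- y ∣ + distance xs ys
distance _        _        = 0

query-runs : {e : Tm Γ (list int)} {xs : List ℤ} → length xs ≡ length (target W) →
  All (λ a → ∣ a ∣ ≤ box W) xs → Runs W ρ e xs p S →
  Runs W ρ (query e) (+ distance xs (target W)) (con 1 :+ p) (suc S)
query-runs {W = world k y _} {xs = xs} len inside (runs d t s)
  with toVec xs (trans len (Vec.length-toList y))
  where
  toVec : ∀ {n} (xs : List ℤ) → length xs ≡ n → Σ[ x ∈ Vec ℤ n ] xs ≡ Vec.toList x
  toVec xs refl = Vec.fromList xs , sym (Vec.toList∘fromList xs)
... | x , refl = value (cong +_ (norm x y)) (runs (Evaluation.⇓query x (inBox x inside) d) (s≤s t) (s≤s s))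
  where
  norm : ∀ {n} (x y : Vec ℤ n) → ‖ x -ᵥ y ‖₁ ≡ distance (Vec.toList x) (Vec.toList y)
  norm Vec.[]       Vec.[]       = refl
  norm (a Vec.∷ x) (b Vec.∷ y) = cong (_+_ ∣ a ℤ.- b ∣) (norm x y)
  inBox : ∀ {n k} (x : Vec ℤ n) → All (λ a → ∣ a ∣ ≤ k) (Vec.toList x) → InBox k x
  inBox Vec.[]       []        = VecAll.[]
  inBox (a Vec.∷ x) (pa ∷ pas) = pa VecAll.∷ inBox x pas

sumℤ : List ℤ → ℤ
sumℤ = foldr ℤ._+_ 0ℤ

total : Tm (list int ∷ []) int
total = foldR v₀ (lit 0ℤ) (add v₁ v₀)

total-runs : Σ[ p ∈ Poly ] (∀ {W} xs → length xs ≤ size W → Runs W (xs ∷ []) total (sumℤ xs) p 0)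
total-runs = _ , λ xs len → no-queries (length xs)
  (proj₂ foldR-runs ℤ._+_ (var-runs _) len (lit-runs _) (always xs)
    λ _ _ _ _ _ → add-runs (var-runs _) (var-runs _))

-- As a function of x this has slope -2 up to y and is constant from y on.
excess : ℤ → ℤ → ℤ
excess x y = + ∣ x ℤ.- y ∣ ℤ.- x

excesses : List ℤ → List ℤ → ℤ
excesses (x ∷ xs) (y ∷ ys) = excess x y ℤ.+ excesses xs ys
excesses _        _        = 0ℤ

-- The sum of the query is known, so it can be subtracted from the answer. With this normalisation
-- an increase of a coordinate has the effect 0 or -2 instead of 1 or -1, and no constant depending
-- on the row remains to be corrected.
probe : Tm (list int ∷ []) int
probe = sub (query v₀) (call total v₀)

probe-runs : Σ[ p ∈ Poly ] (∀ {W} xs → length xs ≡ length (target W) → length xs ≤ size W →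
  All (λ a → ∣ a ∣ ≤ box W) xs → Runs W (xs ∷ []) probe (excesses xs (target W)) p 1)
probe-runs = _ , λ {W} xs len small inside → value (regroup xs (target W) len)
  (sub-runs (query-runs len inside (var-runs _)) (call-runs (var-runs _) (proj₂ total-runs xs small)))
  where
  regroup : ∀ xs ys → length xs ≡ length ys → + distance xs ys ℤ.- sumℤ xs ≡ excesses xs ys
  regroup []       []       _  = refl
  regroup (x ∷ xs) (y ∷ ys) eq = trans (swap (+ ∣ x ℤ.- y ∣) (+ distance xs ys) x (sumℤ xs))
    (cong (ℤ._+_ (excess x y)) (regroup xs ys (suc-injective eq)))
    where
    swap : ∀ a b c d → a ℤ.+ b ℤ.- (c ℤ.+ d) ≡ a ℤ.- c ℤ.+ (b ℤ.- d)
    swap = solve-∀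

-- Rows with entries -1, 0, 1 as pairs of queries

data Trit : ℤ → Set where
  minus : Trit -1ℤ
  none  : Trit 0ℤ
  plus  : Trit 1ℤ

dot : List ℤ → List ℤ → ℤ
dot (r ∷ rs) (x ∷ xs) = r ℤ.* x ℤ.+ dot rs xs
dot _        _        = 0ℤ

neg : List ℤ → List ℤ
neg = map (ℤ._-_ 0ℤ)

-- Only the entry 1 raises; an entry -1 acts through the query for the negated row. With a bit
-- vector in place of a row, the same operation moves the left ends of the intervals.
raise : ℤ → ℤ × ℤ → ℤ
raise δ (r , x) = if 1ℤ ℤ.≤ᵇ r then x ℤ.+ δ else x

shiftBy : List ℤ → List ℤ → ℤ → List ℤ
shiftBy rs xs δ = map (raise δ) (zip rs xs)

-- What one coordinate contributes to a product with a row: `c` is the number that the pair x, x + δ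
-- measures, and both points are admissible in a query. For δ = 1 it is the bit [y > x]; for x = -k
-- and δ = 2k it is y + k. The two branches of the algorithm thus share everything up to
-- `responses`.
record Cell (k : ℕ) (δ x y c : ℤ) : Set where
  constructor cell
  field
    low   : ∣ x ∣ ≤ k
    high  : ∣ x ℤ.+ δ ∣ ≤ k
    swing : excess x y ℤ.- excess (x ℤ.+ δ) y ≡ c ℤ.+ c

data Cells (k : ℕ) (δ : ℤ) : (xs ys cs : List ℤ) → Set where
  []  : Cells k δ [] [] []
  _∷_ : ∀ {x y c xs ys cs} → Cell k δ x y c → Cells k δ xs ys cs → Cells k δ (x ∷ xs) (y ∷ ys) (c ∷ cs)

cells-length : ∀ {k δ xs ys cs} → Cells k δ xs ys cs → length xs ≡ length ys
cells-length []       = refl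
cells-length (_ ∷ cs) = cong suc (cells-length cs)

shift-length : ∀ rs xs {δ} → length xs ≤ length rs → length (shiftBy rs xs δ) ≡ length xs
shift-length []       []       _         = refl
shift-length (r ∷ rs) []       _         = refl
shift-length (r ∷ rs) (x ∷ xs) (s≤s len) = cong suc (shift-length rs xs len)

shift-inside : ∀ {k δ xs ys cs} rs → Cells k δ xs ys cs → All (λ a → ∣ a ∣ ≤ k) (shiftBy rs xs δ)
shift-inside []       _        = []
shift-inside (r ∷ rs) []       = []
shift-inside (r ∷ rs) (cell low high _ ∷ cs) with 1ℤ ℤ.≤ᵇ r
... | true  = high ∷ shift-inside rs cs
... | false = low  ∷ shift-inside rs cs

trit-swing : ∀ {k δ x y c r} → Trit r → Cell k δ x y c →
  excess (raise δ (0ℤ ℤ.- r , x)) y ℤ.- excess (raise δ (r , x)) y ≡ r ℤ.* c ℤ.+ r ℤ.* c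
trit-swing {δ = δ} {x} {y} {c} minus (cell _ _ eq) = trans (flip (excess x y) (excess (x ℤ.+ δ) y))
  (trans (cong ℤ.-_ eq) (double c))
  where
  flip : ∀ a b → b ℤ.- a ≡ ℤ.- (a ℤ.- b)
  flip = solve-∀
  double : ∀ c → ℤ.- (c ℤ.+ c) ≡ -1ℤ ℤ.* c ℤ.+ -1ℤ ℤ.* c
  double = solve-∀
trit-swing {x = x} {y} none (cell _ _ eq) = ℤ.+-inverseʳ (excess x y)
trit-swing {c = c} plus (cell _ _ eq) = trans eq (sym (cong₂ ℤ._+_ (ℤ.*-identityˡ c) (ℤ.*-identityˡ c)))

-- On each coordinate at most one of the two queries is raised, so an entry 1 gives the swing, -1
-- its negative, and 0 gives two equal terms. Rows may be longer than the query, since the matrix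
-- can have more columns than there are coordinates.
row-swing : ∀ {k δ xs ys cs rs} → Cells k δ xs ys cs → All Trit rs → length xs ≤ length rs →
  excesses (shiftBy (neg rs) xs δ) ys ℤ.- excesses (shiftBy rs xs δ) ys ≡ dot rs cs ℤ.+ dot rs cs
row-swing []       []       _ = refl
row-swing []       (_ ∷ _)  _ = refl
row-swing {δ = δ} {xs = x ∷ xs} {ys = y ∷ ys} {cs = c ∷ cs} {rs = r ∷ rs} (cl ∷ cls) (t ∷ ts) (s≤s len) =
  trans (swap (excess (raise δ (0ℤ ℤ.- r , x)) y) (excesses (shiftBy (neg rs) xs δ) ys)
              (excess (raise δ (r , x)) y) (excesses (shiftBy rs xs δ) ys))
    (trans (cong₂ ℤ._+_ (trit-swing t cl) (row-swing cls ts len))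
    (swap′ (r ℤ.* c) (dot rs cs)))
  where
  swap : ∀ a b c d → a ℤ.+ b ℤ.- (c ℤ.+ d) ≡ a ℤ.- c ℤ.+ (b ℤ.- d)
  swap = solve-∀
  swap′ : ∀ a b → a ℤ.+ a ℤ.+ (b ℤ.+ b) ≡ a ℤ.+ b ℤ.+ (a ℤ.+ b)
  swap′ = solve-∀

negate : Tm (list int ∷ []) (list int)
negate = mapL v₀ (sub (lit 0ℤ) v₁)

negate-runs : Σ[ p ∈ Poly ] (∀ {W} xs → length xs ≤ size W → Runs W (xs ∷ []) negate (neg xs) p 0)
negate-runs = _ , λ xs len → no-queries (length xs)
  (proj₂ mapL-runs (ℤ._-_ 0ℤ) (var-runs _) len (always xs) λ _ _ _ _ → sub-runs (lit-runs _) (var-runs _))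

shift : Tm (list int ⊗ list int ⊗ int ∷ []) (list int)
shift = mapL (call zipL (pair (fst v₀) (fst (snd v₀))))
  (if (leq (lit 1ℤ) (fst v₁)) (add (snd v₁) (snd (snd v₄))) (snd v₁))

shift-runs : Σ[ p ∈ Poly ] (∀ {W} rs xs δ → length rs ≤ size W →
  Runs W ((rs , xs , δ) ∷ []) shift (shiftBy rs xs δ) p 0)
shift-runs = _ , λ rs xs δ len → no-queries (length (zip rs xs))
  (proj₂ mapL-runs (raise δ)
    (call-runs (pair-runs (fst-runs (var-runs _)) (fst-runs (snd-runs (var-runs _))))
      (proj₂ zip-runs rs xs len))
    (≤-trans (zip-≤ rs xs) len) (always (zip rs xs))
    λ { (r , x) _ _ _ → if-runs {v = raise δ (r , x)} (leq-runs (lit-runs _) (fst-runs (var-runs _)))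
          (λ eq → value (cong (λ b → if b then x ℤ.+ δ else x) (sym eq))
            (add-runs (snd-runs (var-runs _)) (snd-runs (snd-runs (var-runs _)))))
          (λ eq → value (cong (λ b → if b then x ℤ.+ δ else x) (sym eq)) (snd-runs (var-runs _))) })

probeShifted : Tm (list int ⊗ list int ⊗ int ∷ []) int
probeShifted = call probe (call shift v₀)

probeShifted-runs : Σ[ p ∈ Poly ] (∀ {W δ xs cs} rs → Cells (box W) δ xs (target W) cs →
  length xs ≤ length rs → length rs ≤ size W →
  Runs W ((rs , xs , δ) ∷ []) probeShifted (excesses (shiftBy rs xs δ) (target W)) p 1)
probeShifted-runs = _ , λ {W} {δ} {xs} rs cls len small →
  call-runs (call-runs (var-runs _) (proj₂ shift-runs rs xs δ small))
    (proj₂ probe-runs (shiftBy rs xs δ) (trans (shift-length rs xs len) (cells-length cls))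
      (≤-trans (≤-reflexive (shift-length rs xs len)) (≤-trans len small)) (shift-inside rs cls))

response : Tm (list int ⊗ list int ⊗ int ∷ []) int
response = call half (sub (call probeShifted (pair (call negate (fst v₀)) (snd v₀)))
                          (call probeShifted v₀))

response-runs : Σ[ p ∈ Poly ] (∀ {W δ rs xs cs} → Cells (box W) δ xs (target W) cs → All Trit rs →
  length xs ≤ length rs → length rs ≤ size W → ∣ dot rs cs ℤ.+ dot rs cs ∣ ≤ size W →
  Runs W ((rs , xs , δ) ∷ []) response (dot rs cs) p 2)
response-runs = _ , λ {W} {δ} {rs} {xs} {cs} cls ts len small bound →
  let length-neg = length-map (ℤ._-_ 0ℤ) rs
  in value (trans (cong halve (sym (ℤ.+-identityʳ (dot rs cs ℤ.+ dot rs cs)))) (halve-double (dot rs cs) bit0))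
     (call-runs
       (value (row-swing cls ts len)
         (sub-runs
           (call-runs
             (pair-runs (call-runs (fst-runs (var-runs _)) (proj₂ negate-runs rs small)) (snd-runs (var-runs _)))
             (proj₂ probeShifted-runs (neg rs) cls (≤-trans len (≤-reflexive (sym length-neg)))
               (≤-trans (≤-reflexive length-neg) small)))
           (call-runs (var-runs _) (proj₂ probeShifted-runs rs cls len small))))
       (proj₂ half-runs _ bound))

responses : Tm (list (list int) ⊗ list int ⊗ int ∷ []) (list int)
responses = mapL (fst v₀) (call response (pair v₁ (snd v₄)))

responses-runs : Σ[ p ∈ Poly ] (∀ {W δ rows xs cs} → Cells (box W) δ xs (target W) cs →
  length rows ≤ size W →
  All (λ rs → All Trit rs × length xs ≤ length rs × length rs ≤ size W ×
              ∣ dot rs cs ℤ.+ dot rs cs ∣ ≤ size W) rows →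
  Runs W ((rows , xs , δ) ∷ []) responses (map (λ rs → dot rs cs) rows) p (length rows * 2))
responses-runs = _ , λ cls len good →
  proj₂ mapL-runs (λ rs → dot rs _) (fst-runs (var-runs _)) len good
    λ { rs _ _ (ts , len , small , bound) →
          call-runs (pair-runs (var-runs _) (snd-runs (var-runs _))) (proj₂ response-runs cls ts len small bound) }

-- Cantor–Mills matrices

dot-++ : ∀ rs xs {rs′ xs′} → length rs ≡ length xs →
         dot (rs ++ rs′) (xs ++ xs′) ≡ dot rs xs ℤ.+ dot rs′ xs′
dot-++ []       []       _  = sym (ℤ.+-identityˡ _)
dot-++ (r ∷ rs) (x ∷ xs) eq =
  trans (cong (ℤ._+_ (r ℤ.* x)) (dot-++ rs xs (suc-injective eq))) (sym (ℤ.+-assoc (r ℤ.* x) (dot rs xs) _))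

dot-neg : ∀ rs xs → dot (neg rs) xs ≡ ℤ.- dot rs xs
dot-neg []       _        = refl
dot-neg (r ∷ rs) []       = refl
dot-neg (r ∷ rs) (x ∷ xs) = trans (cong (ℤ._+_ ((0ℤ ℤ.- r) ℤ.* x)) (dot-neg rs xs)) (pull r x (dot rs xs))
  where
  pull : ∀ a b c → (0ℤ ℤ.- a) ℤ.* b ℤ.+ ℤ.- c ≡ ℤ.- (a ℤ.* b ℤ.+ c)
  pull = solve-∀

zeros : ℕ → List ℤ
zeros n = replicate n 0ℤ

dot-zeros : ∀ n xs → dot (zeros n) xs ≡ 0ℤ
dot-zeros zero    _        = refl
dot-zeros (suc n) []       = refl
dot-zeros (suc n) (x ∷ xs) = trans (ℤ.+-identityˡ _) (dot-zeros n xs)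

dot-≤ : ∀ {K rs cs} → All Trit rs → All (λ c → ∣ c ∣ ≤ K) cs → ∣ dot rs cs ∣ ≤ length cs * K
dot-≤ []       _  = z≤n
dot-≤ (t ∷ ts) [] = z≤n
dot-≤ {rs = r ∷ rs} {c ∷ cs} (t ∷ ts) (b ∷ bs) =
  ≤-trans (ℤ.∣i+j∣≤∣i∣+∣j∣ (r ℤ.* c) (dot rs cs))
    (+-mono-≤ (≤-trans (trit-≤ t) b) (dot-≤ ts bs))
  where
  trit-≤ : ∀ {r} → Trit r → ∣ r ℤ.* c ∣ ≤ ∣ c ∣
  trit-≤ minus = ≤-reflexive (trans (cong ∣_∣ (ℤ.-1*i≡-i c)) (ℤ.∣-i∣≡∣i∣ c))
  trit-≤ none  = z≤n
  trit-≤ plus  = ≤-reflexive (cong ∣_∣ (ℤ.*-identityˡ c))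

Row : ℕ → List ℤ → Set
Row c row = length row ≡ c × All Trit row

row-++ : ∀ {a b xs ys} → Row a xs → Row b ys → Row (a + b) (xs ++ ys)
row-++ {xs = xs} (refl , ts) (refl , ts′) = length-++ xs , All.++⁺ ts ts′

row-neg : ∀ {a xs} → Row a xs → Row a (neg xs)
row-neg {xs = xs} (len , ts) = trans (length-map _ xs) len , All.map⁺ (All.map trit-neg ts)
  where
  trit-neg : ∀ {r} → Trit r → Trit (0ℤ ℤ.- r)
  trit-neg minus = plus
  trit-neg none  = none
  trit-neg plus  = minus

row-zeros : ∀ n → Row n (zeros n)
row-zeros n = length-replicate n , All.replicate⁺ n none

unitRows : ℕ → List (List ℤ)
unitRows zero    = []
unitRows (suc n) = (1ℤ ∷ zeros n) ∷ map (0ℤ ∷_) (unitRows n)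

unitRows-length : ∀ n → length (unitRows n) ≡ n
unitRows-length zero    = refl
unitRows-length (suc n) = cong suc (trans (length-map (0ℤ ∷_) (unitRows n)) (unitRows-length n))

unitRows-rows : ∀ n → All (Row n) (unitRows n)
unitRows-rows zero    = []
unitRows-rows (suc n) = (cong suc (proj₁ (row-zeros n)) , plus ∷ proj₂ (row-zeros n)) ∷
  All.map⁺ (All.map (λ (len , ts) → cong suc len , none ∷ ts) (unitRows-rows n))

unitRows-dot : ∀ xs → map (λ e → dot e xs) (unitRows (length xs)) ≡ xs
unitRows-dot []       = refl
unitRows-dot (x ∷ xs) = cong₂ _∷_
  (trans (cong₂ ℤ._+_ (ℤ.*-identityˡ x) (dot-zeros (length xs) xs)) (ℤ.+-identityʳ x))
  (trans (sym (map-∘ (unitRows (length xs))))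
    (trans (map-cong (λ e → ℤ.+-identityˡ (dot e xs)) (unitRows (length xs))) (unitRows-dot xs)))

-- The argument serves as a number in unary. The zero row is built alongside because each new unit
-- row is a 1 followed by the current zero row.
units : Tm (list σ ∷ []) (list (list int) ⊗ list int)
units = foldR v₀ (pair nil nil)
  (pair (cons (cons (lit 1ℤ) (snd v₀)) (mapL (fst v₀) (cons (lit 0ℤ) v₁))) (cons (lit 0ℤ) (snd v₀)))

units-runs : Σ[ p ∈ Poly ] (∀ {W σ} (xs : List ⟦ σ ⟧) → length xs ≤ size W →
  Runs W (xs ∷ []) (units {σ}) (unitRows (length xs) , zeros (length xs)) p 0)
units-runs = _ , λ {W} {σ} xs len → value (spec xs)
  (no-queries (length xs) (proj₂ foldR-runs grow (var-runs _) len (pair-runs nil-runs nil-runs) (always xs)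
    λ x us vs _ us< →
      let small = ≤-trans (≤-trans (≤-reflexive (trans (cong (λ a → length (proj₁ a)) (spec us))
                    (unitRows-length (length us)))) (<⇒≤ us<)) len
          rows  = proj₁ (foldr grow ([] , []) us)
      in  pair-runs
            (cons-runs (cons-runs (lit-runs _) (snd-runs (var-runs _)))
              (no-queries (length rows)
                (proj₂ mapL-runs (0ℤ ∷_) (fst-runs (var-runs _)) small (always rows)
                  λ _ _ _ _ → cons-runs (lit-runs _) (var-runs _))))
            (cons-runs (lit-runs _) (snd-runs (var-runs _)))))
  where
  grow : ∀ {A : Set} → A → List (List ℤ) × List ℤ → List (List ℤ) × List ℤ
  grow _ (rows , zs) = ((1ℤ ∷ zs) ∷ map (0ℤ ∷_) rows , 0ℤ ∷ zs)
  spec : ∀ {A : Set} (xs : List A) → foldr grow ([] , []) xs ≡ (unitRows (length xs) , zeros (length xs))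
  spec []       = refl
  spec (x ∷ xs) = cong (grow x) (spec xs)

-- The two rows that arise from one row stay adjacent, so that a codeword is
-- decoded by reading it in pairs.
twoRows : List ℤ → List ℤ × List ℤ → List (List ℤ) → List (List ℤ)
twoRows zs (e , row) rows = (row ++ row ++ e) ∷ (row ++ neg row ++ zs) ∷ rows

refineRows : List (List ℤ) → List (List ℤ)
refineRows rows = foldr (twoRows (zeros (length rows))) [] (zip (unitRows (length rows)) rows)

All-zip : ∀ {A B : Set} {P : A → Set} {Q : B → Set} {xs ys} →
          All P xs → All Q ys → All (λ (x , y) → P x × Q y) (zip xs ys)
All-zip []         _          = []
All-zip (_ ∷ _)    []         = []
All-zip (px ∷ pxs) (qy ∷ qys) = (px , qy) ∷ All-zip pxs qys

refine : Tm (list (list int) ∷ []) (list (list int))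
refine = let′ (call units v₀)
  (foldR (call zipL (pair (fst v₀) v₁)) nil
    (cons (call append (pair (snd v₁) (call append (pair (snd v₁) (fst v₁)))))
      (cons (call append (pair (snd v₁) (call append (pair (call negate (snd v₁)) (snd v₄))))) v₀)))

refine-runs : Σ[ p ∈ Poly ] (∀ {W} rows → length rows ≤ size W → All (λ row → length row ≤ size W) rows →
  Runs W (rows ∷ []) refine (refineRows rows) p 0)
refine-runs = _ , λ {W} rows len small →
  let us = unitRows (length rows)
      ≤W = ≤-trans (≤-reflexive (unitRows-length (length rows))) len
  in let-runs (call-runs (var-runs _) (proj₂ units-runs rows len))
    (no-queries (length (zip us rows))
      (proj₂ foldR-runs (twoRows (zeros (length rows)))
        (call-runs (pair-runs (fst-runs (var-runs _)) (var-runs _)) (proj₂ zip-runs us rows ≤W))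
        (≤-trans (zip-≤ us rows) ≤W) nil-runs (All-zip (always us) small)
        λ { (e , row) _ _ ((_ , row≤) ∷ _) _ →
          cons-runs
            (call-runs
              (pair-runs (snd-runs (var-runs _))
                (call-runs (pair-runs (snd-runs (var-runs _)) (fst-runs (var-runs _)))
                  (proj₂ append-runs row e row≤)))
              (proj₂ append-runs row _ row≤))
            (cons-runs
              (call-runs
                (pair-runs (snd-runs (var-runs _))
                  (call-runs
                    (pair-runs (call-runs (snd-runs (var-runs _)) (proj₂ negate-runs row row≤))
                      (snd-runs (var-runs _)))
                    (proj₂ append-runs (neg row) _ (≤-trans (≤-reflexive (length-map _ row)) row≤))))
                (proj₂ append-runs row _ row≤))
              (var-runs _)) }))

cols : ℕ → ℕ
cols zero    = 1
cols (suc r) = cols r + (cols r + 2 ^ r)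

mat : ℕ → List (List ℤ)
mat zero    = (1ℤ ∷ []) ∷ []
mat (suc r) = refineRows (mat r)

refine-length : ∀ {c n} {rows : List (List ℤ)} → length rows ≡ n → All (Row c) rows →
                length (refineRows rows) ≡ n + n
refine-length {rows = rows} refl _ = trans (go (unitRows n) rows (unitRows-length n)) refl
  where
  n = length rows
  go : ∀ es rows {zs} → length es ≡ length rows →
       length (foldr (twoRows zs) [] (zip es rows)) ≡ length rows + length rows
  go []       []           _  = refl
  go (e ∷ es) (row ∷ rows) eq = cong suc (trans (cong suc (go es rows (suc-injective eq))) (sym (+-suc _ _)))

refine-rows : ∀ {c n} {rows : List (List ℤ)} → length rows ≡ n → All (Row c) rows →
              All (Row (c + (c + n))) (refineRows rows)
refine-rows {c} {rows = rows} refl good = go (All-zip (unitRows-rows (length rows)) good)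
  where
  go : ∀ {n zs} → All (λ (e , row) → Row n e × Row c row) zs →
       All (Row (c + (c + n))) (foldr (twoRows (zeros n)) [] zs)
  go []                        = []
  go {n} ((e-row , r-row) ∷ more) =
    row-++ r-row (row-++ r-row e-row) ∷ row-++ r-row (row-++ (row-neg r-row) (row-zeros n)) ∷ go more

mat-length : ∀ r → length (mat r) ≡ 2 ^ r
mat-rows : ∀ r → All (Row (cols r)) (mat r)
mat-length zero    = refl
mat-length (suc r) = trans (refine-length (mat-length r) (mat-rows r))
  (cong (_+_ (2 ^ r)) (sym (+-identityʳ (2 ^ r))))
mat-rows zero    = (refl , plus ∷ []) ∷ []
mat-rows (suc r) = refine-rows (mat-length r) (mat-rows r)

2^r≤cols : ∀ r → 2 ^ r ≤ cols r
2^r≤cols zero    = ≤-refl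
2^r≤cols (suc r) = +-mono-≤ (2^r≤cols r) (≤-trans (≤-reflexive (+-identityʳ (2 ^ r))) (m≤n+m (2 ^ r) (cols r)))

-- The matrix and the numbers of its columns and rows.
MatrixState : Ty
MatrixState = list (list int) ⊗ int ⊗ int

narrow : Tm (MatrixState ∷ int ∷ []) bool
narrow = leq (add (fst (snd v₀)) (lit 1ℤ)) v₁

double : Tm (MatrixState ∷ int ∷ []) MatrixState
double = pair (call refine (fst v₀))
  (pair (add (fst (snd v₀)) (add (fst (snd v₀)) (snd (snd v₀)))) (add (snd (snd v₀)) (snd (snd v₀))))

matrix : Tm (int ∷ []) (list (list int))
matrix = fst (while (pair (cons (cons (lit 1ℤ) nil) nil) (pair (lit 1ℤ) (lit 1ℤ))) narrow double)

matrixState : ℕ → ⟦ MatrixState ⟧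
matrixState r = mat r , + cols r , + (2 ^ r)

narrow-runs : Σ[ p ∈ Poly ] (∀ {W} r n →
  Runs W (matrixState r ∷ + n ∷ []) narrow (+ (cols r + 1) ℤ.≤ᵇ + n) p 0)
narrow-runs = _ , λ r n →
  leq-runs (add-runs (fst-runs (snd-runs (var-runs _))) (lit-runs _)) (var-runs _)

double-runs : Σ[ p ∈ Poly ] (∀ {W} r n → cols r ≤ size W →
  Runs W (matrixState r ∷ + n ∷ []) double (matrixState (suc r)) p 0)
double-runs = _ , λ r n small → pair-runs
  (call-runs (fst-runs (var-runs _)) (proj₂ refine-runs (mat r)
    (≤-trans (≤-reflexive (mat-length r)) (≤-trans (2^r≤cols r) small))
    (All.map (λ (len , _) → ≤-trans (≤-reflexive len) small) (mat-rows r))))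
  (pair-runs
    (add-runs (fst-runs (snd-runs (var-runs _)))
      (add-runs (fst-runs (snd-runs (var-runs _))) (snd-runs (snd-runs (var-runs _)))))
    (value (cong (λ l → + (2 ^ r + l)) (sym (+-identityʳ (2 ^ r))))
      (add-runs (snd-runs (snd-runs (var-runs _))) (snd-runs (snd-runs (var-runs _))))))

-- Both inequalities are kept: `n ≤ cols (suc r)` makes the matrix wide enough, and `cols r < n`
-- limits its rows in the query count. As `cols 0 = 1`, the hypothesis `2 ≤ n` forces one round at
-- least, so that the predecessor `r` exists.
matrix-runs : Σ[ p ∈ Poly ] (∀ {W} n → 2 ≤ n → n ≤ size W →
  Σ[ r ∈ ℕ ] cols r < n × n ≤ cols (suc r) × Runs W (+ n ∷ []) matrix (mat (suc r)) p 0)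
matrix-runs = _ , λ n 2≤n n≤ →
  let (r , below , reached , L) = loop n n≤ n 0 2≤n (m≤n+m n 1)
  in r , below , reached ,
     fst-runs (while-runs (pair-runs (cons-runs (cons-runs (lit-runs _) nil-runs) nil-runs)
       (pair-runs (lit-runs _) (lit-runs _))) (con 1 :+ X) (s≤s n≤) L)
  where
  -- The number of columns grows by at least 2^r ≥ 1 in every round, so `n` is fuel enough.
  loop : ∀ {W} n → n ≤ size W → ∀ fuel r → cols r < n → n ≤ cols r + fuel →
    Σ[ r′ ∈ ℕ ] cols r′ < n × n ≤ cols (suc r′) ×
      Loops W (+ n ∷ []) narrow double (proj₁ narrow-runs) (proj₁ double-runs)
        (matrixState r) (matrixState (suc r′)) (suc fuel) 0
  loop n n≤ zero r below enough with () ← <⇒≱ below (≤-trans enough (≤-reflexive (+-identityʳ _)))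
  loop n n≤ (suc fuel) r below enough with n ≤? cols (suc r)
  ... | yes reached = r , below , reached ,
    weaken-rounds (s≤s z≤n)
      (step (value (≤⇒≤ᵇ-true (ℤ.+≤+ (≤-trans (≤-reflexive (+-comm (cols r) 1)) below))) (proj₂ narrow-runs r n))
        (proj₂ double-runs r n (≤-trans (<⇒≤ below) n≤))
        (stop (value (<⇒≤ᵇ-false (ℤ.+<+ (≤-trans (s≤s reached) (≤-reflexive (+-comm 1 (cols (suc r)))))))
          (proj₂ narrow-runs (suc r) n))))
  ... | no more =
    let (r′ , below′ , reached , L) = loop n n≤ fuel (suc r) (≰⇒> more)
          (≤-trans enough (≤-trans (≤-reflexive (+-suc (cols r) fuel))
            (+-monoˡ-≤ fuel (≤-trans (≤-reflexive (+-comm 1 (cols r)))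
              (+-monoʳ-≤ (cols r) (≤-trans (m^n>0 2 r) (m≤n+m (2 ^ r) (cols r))))))))
    in r′ , below′ , reached ,
       step (value (≤⇒≤ᵇ-true (ℤ.+≤+ (≤-trans (≤-reflexive (+-comm (cols r) 1)) below))) (proj₂ narrow-runs r n))
         (proj₂ double-runs r n (≤-trans (<⇒≤ below) n≤)) L

-- Decoding

codeword : List (List ℤ) → List ℤ → List ℤ
codeword rows x = map (λ row → dot row x) rows

Quad : Set
Quad = List ℤ × List ℤ × List ℤ × List ℤ

-- The first component is a buffer with one place. The fold comes from the right, so of a pair it
-- meets b = p - q before x = p + q + w; the sum 2p + w then yields p as its half, w as its parity,
-- and q as the rest of x.
splitStep : ℤ → Quad → Quad
splitStep x ([]    , rest)         = x ∷ [] , rest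
splitStep x (b ∷ _ , ws , us , vs) = [] , w ∷ ws , h ∷ us , (x ℤ.- h ℤ.- w) ∷ vs
  where
  h = halve (x ℤ.+ b)
  w = x ℤ.+ b ℤ.- (h ℤ.+ h)

splitPairs : List ℤ → Quad
splitPairs = foldr splitStep ([] , [] , [] , [])

splitStep-pair : ∀ u v {w} → Bit w → ∀ {ws us vs} →
  splitStep (u ℤ.+ (v ℤ.+ w)) (splitStep (u ℤ.- v) ([] , ws , us , vs)) ≡ ([] , w ∷ ws , u ∷ us , v ∷ vs)
splitStep-pair u v {w} b = cong₂ {B = ℤ × ℤ} (λ h (w , v) → [] , w ∷ _ , h ∷ _ , v ∷ _) h≡ (cong₂ _,_ w≡ v≡)
  where
  h = halve (u ℤ.+ (v ℤ.+ w) ℤ.+ (u ℤ.- v))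
  sum≡ : ∀ u v w → u ℤ.+ (v ℤ.+ w) ℤ.+ (u ℤ.- v) ≡ u ℤ.+ u ℤ.+ w
  sum≡ = solve-∀
  h≡ : h ≡ u
  h≡ = trans (cong halve (sum≡ u v w)) (halve-double u b)
  w≡′ : ∀ u v w → u ℤ.+ (v ℤ.+ w) ℤ.+ (u ℤ.- v) ℤ.- (u ℤ.+ u) ≡ w
  w≡′ = solve-∀
  w≡ : u ℤ.+ (v ℤ.+ w) ℤ.+ (u ℤ.- v) ℤ.- (h ℤ.+ h) ≡ w
  w≡ = trans (cong (λ h → u ℤ.+ (v ℤ.+ w) ℤ.+ (u ℤ.- v) ℤ.- (h ℤ.+ h)) h≡) (w≡′ u v w)
  v≡′ : ∀ u v w → u ℤ.+ (v ℤ.+ w) ℤ.- u ℤ.- w ≡ v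
  v≡′ = solve-∀
  v≡ : u ℤ.+ (v ℤ.+ w) ℤ.- h ℤ.- (u ℤ.+ (v ℤ.+ w) ℤ.+ (u ℤ.- v) ℤ.- (h ℤ.+ h)) ≡ v
  v≡ = trans (cong₂ (λ h w′ → u ℤ.+ (v ℤ.+ w) ℤ.- h ℤ.- w′) h≡ w≡) (v≡′ u v w)

-- Only the last part of the message must consist of bits, for the parity argument. It is read back
-- through the unit rows, whose products with `w` are its entries.
split-codeword : ∀ {c} rows {u v w} → All (Row c) rows → length u ≡ c → length v ≡ c →
  length w ≡ length rows → All Bit w →
  splitPairs (codeword (refineRows rows) (u ++ v ++ w)) ≡ ([] , w , codeword rows u , codeword rows v)
split-codeword {c} rows {u} {v} {w} good u≡ v≡ w≡ bits =
  trans (go (unitRows n) rows (unitRows-length n) good (All.map⁻ (subst (All Bit) (sym units≡) bits)))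
    (cong (λ w′ → [] , w′ , codeword rows u , codeword rows v) units≡)
  where
  n = length rows
  units≡ : codeword (unitRows n) w ≡ w
  units≡ = subst (λ n → codeword (unitRows n) w ≡ w) w≡ (unitRows-dot w)
  x = u ++ v ++ w
  dot-x : ∀ row e → length row ≡ c → dot (row ++ row ++ e) x ≡ dot row u ℤ.+ (dot row v ℤ.+ dot e w)
  dot-x row e row≡ = trans (dot-++ row u (trans row≡ (sym u≡)))
    (cong (ℤ._+_ (dot row u)) (dot-++ row v (trans row≡ (sym v≡))))
  dot-x⁻ : ∀ row n → length row ≡ c → dot (row ++ neg row ++ zeros n) x ≡ dot row u ℤ.- dot row v
  dot-x⁻ row n row≡ = trans (dot-++ row u (trans row≡ (sym u≡)))
    (cong (ℤ._+_ (dot row u))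
      (trans (dot-++ (neg row) v (trans (length-map _ row) (trans row≡ (sym v≡))))
        (trans (cong₂ ℤ._+_ (dot-neg row v) (dot-zeros n w)) (ℤ.+-identityʳ _))))
  go : ∀ {n} es rows → length es ≡ length rows → All (Row c) rows → All (λ e → Bit (dot e w)) es →
       splitPairs (codeword (foldr (twoRows (zeros n)) [] (zip es rows)) x) ≡
         ([] , codeword es w , codeword rows u , codeword rows v)
  go []       []           _  _                   _        = refl
  go {n} (e ∷ es) (row ∷ rows) eq ((row≡ , _) ∷ good) (b ∷ bs) =
    trans (cong₂ splitStep (dot-x row e row≡) (cong₂ splitStep (dot-x⁻ row n row≡) (go es rows (suc-injective eq) good bs)))
      (splitStep-pair (dot row u) (dot row v) b)

split : Tm (list int ∷ []) (list int ⊗ list int ⊗ list int ⊗ list int)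
split = foldR v₀ (pair nil (pair nil (pair nil nil)))
  (uncons (fst v₀) (pair (cons v₁ nil) (snd v₀))
    (let′ (call half (add v₃ v₀))
      (let′ (sub (add v₄ v₁) (add v₀ v₀))
        (pair nil (pair (cons v₀ (fst (snd v₄)))
          (pair (cons v₁ (fst (snd (snd v₄)))) (cons (sub (sub v₅ v₁) v₀) (snd (snd (snd v₄))))))))))

split-runs : Σ[ p ∈ Poly ] (∀ {W} xs B → length xs ≤ size W → All (λ x → ∣ x ∣ ≤ B) xs → B + B ≤ size W →
  Runs W (xs ∷ []) split (splitPairs xs) p 0)
split-runs = _ , λ xs B len small B≤ → no-queries (length xs)
  (proj₂ foldR-runs splitStep (var-runs _) len
    (pair-runs nil-runs (pair-runs nil-runs (pair-runs nil-runs nil-runs))) small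
    λ { x us vs (x≤ ∷ us≤) _ →
      uncons-runs (fst-runs (var-runs _))
        (λ eq → value (sym (first x (splitPairs us) eq))
          (pair-runs (cons-runs (var-runs _) nil-runs) (snd-runs (var-runs _))))
        λ b bs eq → value (sym (second x (splitPairs us) eq))
          (let-runs
            (call-runs (add-runs (var-runs _) (var-runs _))
              (proj₂ half-runs (x ℤ.+ b) (≤-trans (ℤ.∣i+j∣≤∣i∣+∣j∣ x b) (≤-trans
                (+-mono-≤ x≤ (All.head (subst (All (λ x → ∣ x ∣ ≤ B)) eq (pending us us≤)))) B≤))))
            (let-runs (sub-runs (add-runs (var-runs _) (var-runs _)) (add-runs (var-runs _) (var-runs _)))
              (pair-runs nil-runs
                (pair-runs (cons-runs (var-runs _) (fst-runs (snd-runs (var-runs _))))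
                  (pair-runs (cons-runs (var-runs _) (fst-runs (snd-runs (snd-runs (var-runs _)))))
                    (cons-runs (sub-runs (sub-runs (var-runs _) (var-runs _)) (var-runs _))
                      (snd-runs (snd-runs (snd-runs (var-runs _))))))))))})
  where
  first : ∀ x (a : Quad) → proj₁ a ≡ [] → splitStep x a ≡ (x ∷ [] , proj₂ a)
  first x ([] , _) refl = refl
  second : ∀ x (a : Quad) {b bs} → proj₁ a ≡ b ∷ bs →
    let h = halve (x ℤ.+ b)
        w = x ℤ.+ b ℤ.- (h ℤ.+ h)
    in splitStep x a ≡ ([] , w ∷ proj₁ (proj₂ a) , h ∷ proj₁ (proj₂ (proj₂ a)) ,
                          (x ℤ.- h ℤ.- w) ∷ proj₂ (proj₂ (proj₂ a)))
  second x (_ ∷ _ , _) refl = refl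
  pending : ∀ {P : ℤ → Set} xs → All P xs → All P (proj₁ (splitPairs xs))
  pending []       []         = []
  pending (x ∷ xs) (px ∷ pxs) with splitPairs xs | pending xs pxs
  ... | [] , _    | _ = px ∷ []
  ... | b ∷ _ , _ | _ = []

-- The codewords that remain to be decoded, the last one first, and the part of
-- the message after the one that they encode.
DecodeState : Ty
DecodeState = list (list int) ⊗ list int

pending? : Tm (DecodeState ∷ list int ∷ []) bool
pending? = uncons (fst v₀) false′ true′

-- Calls are not recursive, so the recursion over the matrices is carried out on an explicit stack.
-- The message is u, v, w in this order and is assembled from its end: w is output at once and v
-- lies above u.
decodeNext : Tm (DecodeState ∷ list int ∷ []) DecodeState
decodeNext = uncons (fst v₀) v₀ (let′ (call split v₀)
  (uncons (fst v₀)
    (pair (cons (snd (snd (snd v₀))) (cons (fst (snd (snd v₀))) v₂)) (call append (pair (fst (snd v₀)) (snd v₃))))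
    (pair v₄ (cons v₀ (snd v₅)))))

decode : Tm (list int ∷ []) (list int)
decode = snd (while (pair (cons v₀ nil) nil) pending? decodeNext)

nonempty : ∀ {A : Set} → List A → Bool
nonempty []      = false
nonempty (_ ∷ _) = true

pending?-runs : Σ[ p ∈ Poly ] (∀ {W} a stack out →
  Runs W ((stack , out) ∷ a ∷ []) pending? (nonempty stack) p 0)
pending?-runs = _ , λ a stack out → uncons-runs (fst-runs (var-runs _))
  (λ { refl → false-runs }) λ { _ _ refl → true-runs }

-- The codewords of `mat r` have length 2^r, so an entry is left in the buffer exactly for the
-- matrix with one row and one column, where that entry is the message. The stack therefore need not
-- record the depth.
next : Quad → List (List ℤ) → List ℤ → ⟦ DecodeState ⟧
next ([]    , ws , us , vs) stack out = vs ∷ us ∷ stack , ws ++ out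
next (b ∷ _ , _)            stack out = stack , b ∷ out

decodeNext-runs : Σ[ p ∈ Poly ] (∀ {W} a block stack out B → length block ≤ size W →
  All (λ x → ∣ x ∣ ≤ B) block → B + B ≤ size W → length (proj₁ (proj₂ (splitPairs block))) ≤ size W →
  Runs W ((block ∷ stack , out) ∷ a ∷ []) decodeNext (next (splitPairs block) stack out) p 0)
decodeNext-runs = _ , λ a block stack out B len small B≤ ws≤ →
  uncons-runs {q = con 1} (fst-runs (var-runs _)) (λ ()) λ { _ _ refl →
    let-runs (call-runs (var-runs _) (proj₂ split-runs block B len small B≤))
      (uncons-runs (fst-runs (var-runs _))
        (λ eq → value (sym (first (splitPairs block) eq))
          (pair-runs
            (cons-runs (snd-runs (snd-runs (snd-runs (var-runs _))))
              (cons-runs (fst-runs (snd-runs (snd-runs (var-runs _)))) (var-runs _)))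
            (call-runs (pair-runs (fst-runs (snd-runs (var-runs _))) (snd-runs (var-runs _)))
              (proj₂ append-runs _ out ws≤))))
        λ b bs eq → value (sym (second (splitPairs block) eq))
          (pair-runs (var-runs _) (cons-runs (var-runs _) (snd-runs (var-runs _))))) }
  where
  first : ∀ (a : Quad) {stack out} → proj₁ a ≡ [] →
          next a stack out ≡ (proj₂ (proj₂ (proj₂ a)) ∷ proj₁ (proj₂ (proj₂ a)) ∷ stack , proj₁ (proj₂ a) ++ out)
  first ([] , _) refl = refl
  second : ∀ (a : Quad) {b bs stack out} → proj₁ a ≡ b ∷ bs → next a stack out ≡ (stack , b ∷ out)
  second (_ ∷ _ , _) refl = refl

chop : ∀ {A : Set} n {m} (xs : List A) → length xs ≡ n + m →
       Σ[ ys ∈ List A ] Σ[ zs ∈ List A ] xs ≡ ys ++ zs × length ys ≡ n × length zs ≡ m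
chop zero    xs       eq = [] , xs , refl , refl , eq
chop (suc n) (x ∷ xs) eq with chop n xs (suc-injective eq)
... | ys , zs , refl , ys≡ , zs≡ = x ∷ ys , zs , refl , cong suc ys≡ , zs≡

decodeRounds : ℕ → ℕ
decodeRounds zero    = 1
decodeRounds (suc r) = suc (decodeRounds r + decodeRounds r)

-- In continuation form: a loop from the state in which `x` has been output is extended backwards to
-- the state with the codeword of `x` on the stack. The decodings of the two parts then compose by
-- plain application.
decode-loop : ∀ {W} r {x} → length x ≡ cols r → All Bit x → cols r + cols r ≤ size W →
  ∀ {a stack out w m} →
  Loops W (a ∷ []) pending? decodeNext (proj₁ pending?-runs) (proj₁ decodeNext-runs) (stack , x ++ out) w m 0 →
  Loops W (a ∷ []) pending? decodeNext (proj₁ pending?-runs) (proj₁ decodeNext-runs)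
    (codeword (mat r) x ∷ stack , out) w (decodeRounds r + m) 0
decode-loop {W} r {x} x≡ bits small {a} {stack} {out} {w} {m} rest = go r x≡ bits small rest
  where
  Decodes : ⟦ DecodeState ⟧ → ⟦ DecodeState ⟧ → ℕ → Set
  Decodes st w m = Loops W (a ∷ []) pending? decodeNext (proj₁ pending?-runs) (proj₁ decodeNext-runs) st w m 0
  code-≤ : ∀ r {x} → length x ≡ cols r → All Bit x → All (λ c → ∣ c ∣ ≤ cols r) (codeword (mat r) x)
  code-≤ r {x} x≡ bits = All.map⁺ (All.map (λ (_ , ts) → ≤-trans (dot-≤ ts (All.map bit-≤ bits))
    (≤-reflexive (trans (*-identityʳ (length x)) x≡))) (mat-rows r))
  one : ∀ r {x stack out m} → length x ≡ cols r → All Bit x → cols r + cols r ≤ size W →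
        length (proj₁ (proj₂ (splitPairs (codeword (mat r) x)))) ≤ size W →
        Decodes (next (splitPairs (codeword (mat r) x)) stack out) w m →
        Decodes (codeword (mat r) x ∷ stack , out) w (suc m)
  one r {x} x≡ bits small ws≤ = step (proj₂ pending?-runs _ _ _)
    (proj₂ decodeNext-runs a (codeword (mat r) x) _ _ (cols r)
      (≤-trans (≤-reflexive (trans (length-map _ (mat r)) (mat-length r)))
        (≤-trans (2^r≤cols r) (≤-trans (m≤m+n (cols r) (cols r)) small)))
      (code-≤ r x≡ bits) small ws≤)
  go : ∀ r {x stack out m} → length x ≡ cols r → All Bit x → cols r + cols r ≤ size W →
       Decodes (stack , x ++ out) w m → Decodes (codeword (mat r) x ∷ stack , out) w (decodeRounds r + m)
  go zero {b ∷ []} {stack} {out} {m} x≡ bits small rest =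
    one zero x≡ bits small z≤n (subst (λ b′ → Decodes (stack , b′ ∷ out) w m)
      (sym (trans (ℤ.+-identityʳ (1ℤ ℤ.* b)) (ℤ.*-identityˡ b))) rest)
  go (suc r) {x} {stack} {out} {m} x≡ bits small rest with chop (cols r) x x≡
  ... | u , vw , refl , u≡ , vw≡ with chop (cols r) vw vw≡
  ...   | v , w′ , refl , v≡ , w≡ =
    weaken-rounds (≤-reflexive (cong suc (sym (+-assoc D D m))))
      (one (suc r) x≡ bits small
        (≤-trans (≤-reflexive (trans (cong (λ a → length (proj₁ (proj₂ a))) split≡) w≡))
          (≤-trans (2^r≤cols r) (≤-trans (m≤m+n (cols r) _) cols≤)))
        (subst (λ a → Decodes (next a stack out) w (D + (D + m))) (sym split≡)
          (go r v≡ v-bits small′ (go r u≡ u-bits small′ (subst (λ o → Decodes (stack , o) w m) regroup rest)))))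
    where
    D = decodeRounds r
    u-bits = All.++⁻ˡ u bits
    v-bits = All.++⁻ˡ v (All.++⁻ʳ u bits)
    cols≤ : cols (suc r) ≤ size W
    cols≤ = ≤-trans (m≤m+n (cols (suc r)) (cols (suc r))) small
    small′ : cols r + cols r ≤ size W
    small′ = ≤-trans (+-monoʳ-≤ (cols r) (m≤m+n (cols r) (2 ^ r))) cols≤
    split≡ : splitPairs (codeword (mat (suc r)) (u ++ v ++ w′)) ≡
             ([] , w′ , codeword (mat r) u , codeword (mat r) v)
    split≡ = split-codeword (mat r) (mat-rows r) u≡ v≡ (trans w≡ (sym (mat-length r)))
      (All.++⁻ʳ v (All.++⁻ʳ u bits))
    regroup : (u ++ v ++ w′) ++ out ≡ u ++ (v ++ (w′ ++ out))
    regroup = trans (++-assoc u (v ++ w′) out) (cong (u ++_) (++-assoc v w′ out))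

decode-runs : Σ[ p ∈ Poly ] (∀ {W} r x → length x ≡ cols r → All Bit x → cols r + cols r ≤ size W →
  Runs W (codeword (mat r) x ∷ []) decode x p 0)
decode-runs = _ , λ r x x≡ bits small → value (++-identityʳ x)
  (snd-runs (while-runs (pair-runs (cons-runs (var-runs _) nil-runs) nil-runs) X
    (≤-trans (≤-reflexive (+-identityʳ _)) (≤-trans (rounds-≤ r) small))
    (decode-loop r x≡ bits small (stop (proj₂ pending?-runs _ _ _)))))
  where
  rounds≡ : ∀ r → suc (decodeRounds r) ≡ 2 ^ r + 2 ^ r
  rounds≡ zero    = refl
  rounds≡ (suc r) = trans (cong suc (sym (+-suc D D)))
    (trans (cong₂ _+_ (rounds≡ r) (rounds≡ r)) (cong (λ l → 2 ^ r + l + (2 ^ r + l)) (sym (+-identityʳ (2 ^ r)))))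
    where
    D = decodeRounds r
  rounds-≤ : ∀ r → decodeRounds r ≤ cols r + cols r
  rounds-≤ r = ≤-trans (n≤1+n _) (≤-trans (≤-reflexive (rounds≡ r)) (+-mono-≤ (2^r≤cols r) (2^r≤cols r)))

-- Simultaneous bisection

offset-≤ : ∀ {k a} → a ≤ k + k → ∣ ℤ.- + k ℤ.+ + a ∣ ≤ k
offset-≤ {k} {a} a≤ = subst (λ i → ∣ i ∣ ≤ k) (sym (ℤ.-m+n≡n⊖m k a)) bound
  where
  bound : ∣ a ⊖ k ∣ ≤ k
  bound with ≤-total a k
  ... | inj₁ a≤k = ≤-trans (≤-reflexive (ℤ.∣⊖∣-≤ a≤k)) (m∸n≤m k a)
  ... | inj₂ k≤a = ≤-trans (≤-reflexive (trans (ℤ.∣m⊖n∣≡∣n⊖m∣ a k) (ℤ.∣⊖∣-≤ k≤a))) (m≤n+o⇒m∸n≤o a k a≤)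

excess-left : ∀ x d → excess x (x ℤ.+ + d) ≡ + d ℤ.- x
excess-left x d = cong (λ e → + e ℤ.- x)
  (trans (cong ∣_∣ (cancel x (+ d))) (ℤ.∣-i∣≡∣i∣ (+ d)))
  where
  cancel : ∀ x d → x ℤ.- (x ℤ.+ d) ≡ ℤ.- d
  cancel = solve-∀

excess-right : ∀ y d → excess (y ℤ.+ + d) y ≡ + d ℤ.- (y ℤ.+ + d)
excess-right y d = cong (λ e → + ∣ e ∣ ℤ.- (y ℤ.+ + d)) (cancel y (+ d))
  where
  cancel : ∀ y d → y ℤ.+ d ℤ.- y ≡ d
  cancel = solve-∀

-- -k ≤ l ≤ y ≤ l + w ≤ k, by means of left = l + k and gap = y - l.
record Near (k w : ℕ) (l y : ℤ) : Set where
  constructor near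
  field
    {left gap} : ℕ
    l≡   : l ≡ ℤ.- + k ℤ.+ + left
    y≡   : y ≡ l ℤ.+ + gap
    gap≤ : gap ≤ w
    fits : left + w ≤ k + k

swing-below : ∀ m e → excess m (m ℤ.+ + suc e) ℤ.- excess (m ℤ.+ 1ℤ) (m ℤ.+ + suc e) ≡ + 2
swing-below m e = trans (cong₂ ℤ._-_ (excess-left m (suc e))
    (trans (cong (excess (m ℤ.+ 1ℤ)) (sym (ℤ.+-assoc m 1ℤ (+ e)))) (excess-left (m ℤ.+ 1ℤ) e)))
  (simplify m (+ e))
  where
  simplify : ∀ m e → 1ℤ ℤ.+ e ℤ.- m ℤ.- (e ℤ.- (m ℤ.+ 1ℤ)) ≡ + 2
  simplify = solve-∀

swing-above : ∀ y d → excess (y ℤ.+ + d) y ℤ.- excess (y ℤ.+ + d ℤ.+ 1ℤ) y ≡ 0ℤ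
swing-above y d = trans (cong₂ ℤ._-_ (excess-right y d)
    (trans (cong (λ x → excess x y) (trans (ℤ.+-assoc y (+ d) 1ℤ) (cong (λ e → y ℤ.+ + e) (+-comm d 1))))
      (excess-right y (suc d))))
  (simplify y (+ d))
  where
  simplify : ∀ y d → d ℤ.- (y ℤ.+ d) ℤ.- (1ℤ ℤ.+ d ℤ.- (y ℤ.+ (1ℤ ℤ.+ d))) ≡ 0ℤ
  simplify = solve-∀

-- The interval has h + t + 2 points. If y > l + t, the upper h + 1 of them remain. Otherwise the
-- lower t + 1 remain, and they are padded to h + 1 points, which keeps the width common to all
-- coordinates; as t ≤ h, the padded interval still lies inside the old one.
near-cell : ∀ {k h t l y} → t ≤ h → Near k (h + suc t) l y →
  Σ[ c ∈ ℤ ] Bit c × Cell k 1ℤ (l ℤ.+ + t) y c × Near k h (raise (+ suc t) (c , l)) y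
near-cell {k} {h} {t} {l} t≤h (near {a} {b} l≡ refl b≤ fits) = found (suc t ≤? b)
  where
  at : ∀ e → l ℤ.+ + e ≡ ℤ.- + k ℤ.+ + (a + e)
  at e = trans (cong (λ l → l ℤ.+ + e) l≡) (ℤ.+-assoc (ℤ.- + k) (+ a) (+ e))
  inside : ∀ e → e ≤ h + suc t → ∣ l ℤ.+ + e ∣ ≤ k
  inside e e≤ = subst (λ x → ∣ x ∣ ≤ k) (sym (at e)) (offset-≤ (≤-trans (+-monoʳ-≤ a e≤) fits))
  low : ∣ l ℤ.+ + t ∣ ≤ k
  low = inside t (≤-trans (n≤1+n t) (m≤n+m (suc t) h))
  t+1 : l ℤ.+ + t ℤ.+ 1ℤ ≡ l ℤ.+ + suc t
  t+1 = trans (ℤ.+-assoc l (+ t) 1ℤ) (cong (λ e → l ℤ.+ + e) (+-comm t 1))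
  high : ∣ l ℤ.+ + t ℤ.+ 1ℤ ∣ ≤ k
  high = subst (λ x → ∣ x ∣ ≤ k) (sym t+1) (inside (suc t) (m≤n+m (suc t) h))
  found : _ → _
  found (yes t<b) with m≤n⇒∃[o]m+o≡n t<b
  ... | e , refl = 1ℤ , bit1 ,
    cell low high (subst (λ y → excess (l ℤ.+ + t) y ℤ.- excess (l ℤ.+ + t ℤ.+ 1ℤ) y ≡ + 2)
      (trans (ℤ.+-assoc l (+ t) (+ suc e)) (cong (λ b → l ℤ.+ + b) (+-suc t e)))
      (swing-below (l ℤ.+ + t) e)) ,
    near (at (suc t)) (sym (ℤ.+-assoc l (+ suc t) (+ e)))
      (+-cancelˡ-≤ (suc t) e h (≤-trans b≤ (≤-reflexive (+-comm h (suc t)))))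
      (≤-trans (≤-reflexive (trans (+-assoc a (suc t) h) (cong (_+_ a) (+-comm (suc t) h)))) fits)
  found (no b≤t) with m≤n⇒∃[o]m+o≡n (≮⇒≥ b≤t)
  ... | d , refl = 0ℤ , bit0 ,
    cell low high (subst (λ x → excess x (l ℤ.+ + b) ℤ.- excess (x ℤ.+ 1ℤ) (l ℤ.+ + b) ≡ 0ℤ)
      (ℤ.+-assoc l (+ b) (+ d)) (swing-above (l ℤ.+ + b) d)) ,
    near l≡ refl (≤-trans (m≤m+n b d) t≤h) (≤-trans (+-monoʳ-≤ a (m≤m+n h _)) fits)

near-cells : ∀ {k h t ls ys} → t ≤ h → Pointwise (Near k (h + suc t)) ls ys →
  Σ[ cs ∈ List ℤ ] All Bit cs × length cs ≡ length ls × Cells k 1ℤ (map (λ l → l ℤ.+ + t) ls) ys cs ×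
    Pointwise (Near k h) (shiftBy cs ls (+ suc t)) ys
near-cells t≤h []       = [] , [] , refl , [] , []
near-cells t≤h (n ∷ ns) with near-cell t≤h n | near-cells t≤h ns
... | c , b , cl , n′ | cs , bs , len , cls , ns′ = c ∷ cs , b ∷ bs , cong suc len , cl ∷ cls , n′ ∷ ns′

-- Decoding expects a message as long as the rows. The bits of the missing coordinates are taken to
-- be 0, which leaves the responses as they are.
dot-pad : ∀ rs xs n → dot rs (xs ++ zeros n) ≡ dot rs xs
dot-pad []       xs       n       = refl
dot-pad (r ∷ rs) (x ∷ xs) n       = cong (ℤ._+_ (r ℤ.* x)) (dot-pad rs xs n)
dot-pad (r ∷ rs) []       zero    = refl
dot-pad (r ∷ rs) []       (suc n) = cong₂ ℤ._+_ (ℤ.*-zeroʳ r) (trans (dot-pad rs [] n) (dot-[] rs))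
  where
  dot-[] : ∀ rs → dot rs [] ≡ 0ℤ
  dot-[] []       = refl
  dot-[] (_ ∷ _) = refl

shift-pad : ∀ rs rs′ xs {δ} → length rs ≡ length xs → shiftBy (rs ++ rs′) xs δ ≡ shiftBy rs xs δ
shift-pad []       rs′ []       _  = cong (map _) (zip-[] rs′)
shift-pad (r ∷ rs) rs′ (x ∷ xs) eq = cong (_ ∷_) (shift-pad rs rs′ xs (suc-injective eq))

SearchState : Ty
SearchState = int ⊗ list int

wide : Tm (SearchState ∷ list (list int) ⊗ SearchState ∷ []) bool
wide = leq (lit 1ℤ) (fst v₀)

padded-length : ∀ (cs : List ℤ) n → length cs ≤ n → length (cs ++ zeros (n ∸ length cs)) ≡ n
padded-length cs n cs≤ = trans (length-++ cs)
  (trans (cong (_+_ (length cs)) (length-replicate (n ∸ length cs))) (m+[n∸m]≡n cs≤))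

findBits : Tm (list (list int) ⊗ list int ∷ []) (list int)
findBits = call decode (call responses (pair (fst v₀) (pair (snd v₀) (lit 1ℤ))))

findBits-runs : Σ[ p ∈ Poly ] (∀ {W} r {xs cs} → Cells (box W) 1ℤ xs (target W) cs → All Bit cs →
  length xs ≤ cols r → length cs ≤ cols r → cols r + cols r ≤ size W →
  Runs W ((mat r , xs) ∷ []) findBits (cs ++ zeros (cols r ∸ length cs)) p (2 ^ r * 2))
findBits-runs = _ , λ r {xs} {cs} cells bits xs≤ cs≤ small →
  weaken-queries (≤-reflexive (trans (+-identityʳ _) (cong (_* 2) (mat-length r))))
    (call-runs
      (value (map-cong (λ rs → sym (dot-pad rs _ _)) (mat r))
        (call-runs (pair-runs (fst-runs (var-runs _)) (pair-runs (snd-runs (var-runs _)) (lit-runs _)))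
          (proj₂ responses-runs cells
            (≤-trans (≤-reflexive (mat-length r)) (≤-trans (2^r≤cols r) (half≤ r small)))
            (rows-good r {xs} {cs} bits xs≤ cs≤ small))))
      (proj₂ decode-runs r _ (padded-length cs (cols r) cs≤) (All.++⁺ bits (All.replicate⁺ _ bit0)) small))
  where
  half≤ : ∀ {s} r → cols r + cols r ≤ s → cols r ≤ s
  half≤ r = ≤-trans (m≤m+n (cols r) (cols r))
  rows-good : ∀ {s} r {xs cs : List ℤ} → All Bit cs → length xs ≤ cols r → length cs ≤ cols r → cols r + cols r ≤ s →
    All (λ rs → All Trit rs × length xs ≤ length rs × length rs ≤ s × ∣ dot rs cs ℤ.+ dot rs cs ∣ ≤ s) (mat r)
  rows-good r {xs} {cs} bits xs≤ cs≤ small = All.map good (mat-rows r)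
    where
    good : ∀ {rs} → Row (cols r) rs → _
    good {rs} (len , ts) = ts , ≤-trans xs≤ (≤-reflexive (sym len)) , ≤-trans (≤-reflexive len) (half≤ r small) ,
      ≤-trans (ℤ.∣i+j∣≤∣i∣+∣j∣ (dot rs cs) (dot rs cs)) (≤-trans (+-mono-≤ d≤ d≤) small)
      where
      d≤ = ≤-trans (dot-≤ ts (All.map bit-≤ bits)) (≤-trans (≤-reflexive (*-identityʳ (length cs))) cs≤)

bisect : Tm (SearchState ∷ list (list int) ⊗ SearchState ∷ []) SearchState
bisect = let′ (call half (fst v₀)) (let′ (sub (fst v₁) v₀)
  -- The two variables bound so far are h = ⌊w/2⌋ and w - h = t + 1. The lower probing points are l
  -- + t, hence the subtraction of 1, while an interval whose bit is 1 moves by t + 1.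
  (let′ (call findBits (pair (fst v₃) (mapL (snd v₂) (add v₁ (sub v₄ (lit 1ℤ))))))
    (pair v₂ (call shift (pair v₀ (pair (snd v₃) v₁))))))

search : Tm (list (list int) ⊗ SearchState ∷ []) (list int)
search = snd (while (snd v₀) wide bisect)

wide-runs : Σ[ p ∈ Poly ] (∀ {W} w ls a → Runs W ((w , ls) ∷ a ∷ []) wide (1ℤ ℤ.≤ᵇ w) p 0)
wide-runs = _ , λ w ls a → leq-runs (lit-runs _) (fst-runs (var-runs _))

halfway : ∀ w → suc w ≡ ⌊ suc w /2⌋ + suc ⌊ w /2⌋
halfway w = sym (⌊n/2⌋+⌈n/2⌉≡n (suc w))

width : ∀ w → + suc w ℤ.- + ⌊ suc w /2⌋ ≡ + suc ⌊ w /2⌋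
width w = trans (cong (λ v → + v ℤ.- + h) (halfway w)) (cancel (+ h) (+ suc ⌊ w /2⌋))
  where
  h = ⌊ suc w /2⌋
  cancel : ∀ a b → a ℤ.+ b ℤ.- a ≡ b
  cancel = solve-∀

bisect-runs : Σ[ p ∈ Poly ] (∀ {W} r w ls a → Pointwise (Near (box W) (suc w)) ls (target W) →
  length ls ≤ cols r → cols r + cols r ≤ size W → suc w ≤ size W →
  Σ[ ls′ ∈ List ℤ ] Pointwise (Near (box W) ⌊ suc w /2⌋) ls′ (target W) ×
    Runs W ((+ suc w , ls) ∷ (mat r , a) ∷ []) bisect (+ ⌊ suc w /2⌋ , ls′) p (2 ^ r * 2))
bisect-runs = _ , λ {W} r w ls a nears len small w≤ →
  let (cs , bits , cs≡ , cells , nears′) = near-cells (⌊n/2⌋-mono (n≤1+n w))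
        (subst (λ v → Pointwise (Near (box W) v) ls (target W)) (halfway w) nears)
  in shiftBy cs ls (+ suc ⌊ w /2⌋) , nears′ , proj₂ raise-runs r w ls a cs bits cs≡ cells len small w≤
  where
  raise-runs : Σ[ p ∈ Poly ] (∀ {W} r w ls a cs → All Bit cs → length cs ≡ length ls →
    Cells (box W) 1ℤ (map (λ l → l ℤ.+ + ⌊ w /2⌋) ls) (target W) cs →
    length ls ≤ cols r → cols r + cols r ≤ size W → suc w ≤ size W →
    Runs W ((+ suc w , ls) ∷ (mat r , a) ∷ []) bisect
      (+ ⌊ suc w /2⌋ , shiftBy cs ls (+ suc ⌊ w /2⌋)) p (2 ^ r * 2))
  raise-runs = _ , λ r w ls a cs bits cs≡ cells len small w≤ →
    weaken-queries (≤-reflexive (+-identityʳ _))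
    (let-runs (call-runs (fst-runs (var-runs _)) (proj₂ half-runs (+ suc w) w≤))
      (let-runs (value (width w) (sub-runs (fst-runs (var-runs _)) (var-runs _)))
        (let-runs
          (call-runs
            (pair-runs (fst-runs (var-runs _))
              (no-queries (length ls) (proj₂ mapL-runs (λ l → l ℤ.+ + ⌊ w /2⌋) (snd-runs (var-runs _))
                (≤-trans len (≤-trans (m≤m+n _ _) small)) (always ls)
                λ _ _ _ _ → add-runs (var-runs _) (sub-runs (var-runs _) (lit-runs _)))))
            (proj₂ findBits-runs r cells bits (≤-trans (≤-reflexive (length-map _ ls)) len)
              (≤-trans (≤-reflexive cs≡) len) small))
          (pair-runs (var-runs _)
            (value (shift-pad cs _ ls cs≡)
              (call-runs (pair-runs (var-runs _) (pair-runs (snd-runs (var-runs _)) (var-runs _)))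
                (proj₂ shift-runs _ ls _
                  (≤-trans (≤-reflexive (padded-length cs (cols r) (≤-trans (≤-reflexive cs≡) len)))
                    (≤-trans (m≤m+n _ _) small)))))))))

weaken-loop-queries : ∀ {ρ : Env Γ} {c : Tm (σ ∷ Γ) bool} {e v w} → S₁ ≤ S₂ →
  Loops W ρ c e p q v w m S₁ → Loops W ρ c e p q v w m S₂
weaken-loop-queries S≤ (loops d t s) = loops d t (≤-trans s S≤)

-- `L` is an upper bound for the number of rounds: halving takes a width below 2^(L+1) to one below
-- 2^L, and below 2^0 the intervals are single points.
search-runs : Σ[ p ∈ Poly ] (∀ {W} r L w ls → w < 2 ^ L → L ≤ size W →
  Pointwise (Near (box W) w) ls (target W) → length ls ≤ cols r →
  cols r + cols r ≤ size W → w ≤ size W →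
  Runs W ((mat r , + w , ls) ∷ []) search (target W) p (L * (2 ^ r * 2)))
search-runs = _ , λ r L w ls w< L≤ nears len small w≤ →
  snd-runs (while-runs (snd-runs (var-runs _)) X L≤ (loop r L w ls w< nears len small w≤))
  where
  found : ∀ {k ls ys} → Pointwise (Near k 0) ls ys → ls ≡ ys
  found []                            = refl
  found (near _ y≡ z≤n _ ∷ ns) = cong₂ _∷_ (sym (trans y≡ (ℤ.+-identityʳ _))) (found ns)
  near-length : ∀ {k w ls ys} → Pointwise (Near k w) ls ys → length ls ≡ length ys
  near-length []       = refl
  near-length (_ ∷ ns) = cong suc (near-length ns)
  done : ∀ {W a ls} m S → Pointwise (Near (box W) 0) ls (target W) →
    Loops W (a ∷ []) wide bisect (proj₁ wide-runs) (proj₁ bisect-runs) (0ℤ , ls) (0ℤ , target W) m S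
  done {W} {a} {ls} m S nears = weaken-rounds z≤n (weaken-loop-queries z≤n
    (subst (λ ys → Loops W (a ∷ []) wide bisect (proj₁ wide-runs) (proj₁ bisect-runs) (0ℤ , ls) (0ℤ , ys) 0 0)
      (found nears) (stop (proj₂ wide-runs _ _ _))))
  loop : ∀ {W a} r L w ls → w < 2 ^ L → Pointwise (Near (box W) w) ls (target W) →
    length ls ≤ cols r → cols r + cols r ≤ size W → w ≤ size W →
    Loops W ((mat r , a) ∷ []) wide bisect (proj₁ wide-runs) (proj₁ bisect-runs)
      (+ w , ls) (0ℤ , target W) L (L * (2 ^ r * 2))
  loop r zero    zero    ls w< nears len small w≤ = done _ _ nears
  loop r zero    (suc w) ls (s≤s ()) nears len small w≤
  loop r (suc L) zero    ls w< nears len small w≤ = done _ _ nears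
  loop {W} {a} r (suc L) (suc w) ls w< nears len small w≤ =
    let (ls′ , nears′ , R) = proj₂ bisect-runs r w ls a nears len small w≤
    in  step (proj₂ wide-runs (+ suc w) ls _) R
          (loop r L ⌊ suc w /2⌋ ls′ below nears′
            (≤-trans (≤-reflexive (trans (near-length nears′) (sym (near-length nears)))) len) small
            (≤-trans (⌊n/2⌋≤n (suc w)) w≤))
    where
    below : ⌊ suc w /2⌋ < 2 ^ L
    below = ≰⇒> λ L≤ → <⇒≱ w< (≤-trans (+-mono-≤ L≤ (≤-trans (≤-reflexive (+-identityʳ _)) L≤))
      (≤-trans (+-monoʳ-≤ ⌊ suc w /2⌋ (⌊n/2⌋≤⌈n/2⌉ (suc w))) (≤-reflexive (⌊n/2⌋+⌈n/2⌉≡n (suc w)))))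

-- The algorithm

copies : Tm (int ⊗ int ∷ []) (list int)
copies = snd (while (pair (fst v₀) nil) (leq (lit 1ℤ) (fst v₀))
  (pair (sub (fst v₀) (lit 1ℤ)) (cons (snd v₁) (snd v₀))))

copies-runs : Σ[ p ∈ Poly ] (∀ {W} n a → n ≤ size W → Runs W ((+ n , a) ∷ []) copies (replicate n a) p 0)
copies-runs = _ , λ n a n≤ →
  snd-runs (while-runs (pair-runs (fst-runs (var-runs _)) nil-runs) X n≤ (loop n a n 0 (+-identityʳ n)))
  where
  loop : ∀ {W} n a i j → i + j ≡ n →
    Loops W ((+ n , a) ∷ []) (leq (lit 1ℤ) (fst v₀)) (pair (sub (fst v₀) (lit 1ℤ)) (cons (snd v₁) (snd v₀)))
      (after (con 1) (con 1 :+ con 1))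
      (after (after (con 1 :+ con 1) (con 1)) (after (con 1 :+ con 1) (con 1 :+ con 1)))
      (+ i , replicate j a) (0ℤ , replicate n a) i 0
  loop n a zero    j refl = stop (leq-runs (lit-runs _) (fst-runs (var-runs _)))
  loop n a (suc i) j eq   = step (leq-runs (lit-runs _) (fst-runs (var-runs _)))
    (pair-runs (sub-runs (fst-runs (var-runs _)) (lit-runs _))
      (cons-runs (snd-runs (var-runs _)) (snd-runs (var-runs _))))
    (loop n a i (suc j) (trans (+-suc i j) eq))

sums : List ℤ → List ℤ → List ℤ
sums xs ys = map (λ (x , y) → x ℤ.+ y) (zip xs ys)

sumL : Tm (list int ⊗ list int ∷ []) (list int)
sumL = mapL (call zipL v₀) (add (fst v₁) (snd v₁))

sumL-runs : Σ[ p ∈ Poly ] (∀ {W} xs ys → length xs ≤ size W → Runs W ((xs , ys) ∷ []) sumL (sums xs ys) p 0)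
sumL-runs = _ , λ xs ys len → no-queries (length (zip xs ys))
  (proj₂ mapL-runs (λ (x , y) → x ℤ.+ y) (call-runs (var-runs _) (proj₂ zip-runs xs ys len))
    (≤-trans (zip-≤ xs ys) len) (always (zip xs ys))
    λ _ _ _ _ → add-runs (fst-runs (var-runs _)) (snd-runs (var-runs _)))

-- From x = -k and δ = 2k a coordinate has the swing 2 (y + k). The unit rows thus return y + k, to
-- which -k is added.
coordinatewise : Tm (list int ∷ int ∷ int ∷ []) (list int)
coordinatewise = call sumL (pair v₀ (call responses (pair (fst (call units v₀)) (pair v₀ (add v₂ v₂)))))

logarithmic : Tm (list int ∷ int ∷ int ∷ []) (list int)
logarithmic = call search (pair (call matrix v₁) (pair (add v₂ v₂) v₀))

recover : Algorithm
recover = let′ (call copies (pair v₀ (sub (lit 0ℤ) v₁))) (if (leq v₁ v₂) coordinatewise logarithmic)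

above-low : ∀ {k} y → ∣ y ∣ ≤ k → Σ[ b ∈ ℕ ] Σ[ e ∈ ℕ ] y ≡ ℤ.- + k ℤ.+ + b × b + e ≡ k + k
above-low {k} (+ m) m≤k with m≤n⇒∃[o]m+o≡n m≤k
... | e , refl = m + e + m , e , cancel (+ (m + e)) (+ m) , ℕ-swap m e
  where
  cancel : ∀ k m → m ≡ ℤ.- k ℤ.+ (k ℤ.+ m)
  cancel = solve-∀
  ℕ-swap : ∀ m e → m + e + m + e ≡ m + e + (m + e)
  ℕ-swap = ℕ.solve-∀
above-low {k} -[1+ m ] m<k with m≤n⇒∃[o]m+o≡n m<k
... | b , refl = b , suc m + b + suc m , cancel (+ suc m) (+ b) , ℕ-swap (suc m) b
  where
  cancel : ∀ m b → ℤ.- m ≡ ℤ.- (m ℤ.+ b) ℤ.+ b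
  cancel = solve-∀
  ℕ-swap : ∀ m b → b + (m + b + m) ≡ m + b + (m + b)
  ℕ-swap = ℕ.solve-∀

swing-across : ∀ x b e → excess x (x ℤ.+ + b) ℤ.- excess (x ℤ.+ (+ (b + e))) (x ℤ.+ + b) ≡ + b ℤ.+ + b
swing-across x b e = trans (cong₂ ℤ._-_ (excess-left x b)
    (trans (cong (λ z → excess z (x ℤ.+ + b)) (sym (ℤ.+-assoc x (+ b) (+ e)))) (excess-right (x ℤ.+ + b) e)))
  (simplify x (+ b) (+ e))
  where
  simplify : ∀ x b e → b ℤ.- x ℤ.- (e ℤ.- (x ℤ.+ b ℤ.+ e)) ≡ b ℤ.+ b
  simplify = solve-∀

low-cells : ∀ {n k} {y : Vec ℤ n} → InBox k y →
  Σ[ cs ∈ List ℤ ] All (λ c → ∣ c ∣ ≤ k + k) cs × length cs ≡ n ×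
    Cells k (+ (k + k)) (replicate n (ℤ.- + k)) (Vec.toList y) cs ×
    sums (replicate n (ℤ.- + k)) cs ≡ Vec.toList y
low-cells VecAll.[] = [] , [] , refl , [] , refl
low-cells {k = k} {a Vec.∷ y} (a≤ VecAll.∷ y≤) with above-low a a≤ | low-cells y≤
... | b , e , refl , be≡ | cs , cs≤ , cs≡ , cells , sum≡ =
  + b ∷ cs , m+n≤o⇒m≤o b (≤-reflexive be≡) ∷ cs≤ , cong suc cs≡ ,
  cell (≤-reflexive (ℤ.∣-i∣≡∣i∣ (+ k))) (offset-≤ ≤-refl)
    (subst (λ δ → excess (ℤ.- + k) (ℤ.- + k ℤ.+ + b) ℤ.- excess (ℤ.- + k ℤ.+ + δ) (ℤ.- + k ℤ.+ + b) ≡ + b ℤ.+ + b)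
      be≡ (swing-across (ℤ.- + k) b e)) ∷ cells ,
  cong (_ ∷_) sum≡

low-near : ∀ {n k} {y : Vec ℤ n} → InBox k y →
  Pointwise (Near k (k + k)) (replicate n (ℤ.- + k)) (Vec.toList y)
low-near VecAll.[] = []
low-near {y = a Vec.∷ _} (a≤ VecAll.∷ y≤) with above-low a a≤
... | b , e , refl , be≡ =
  near (sym (ℤ.+-identityʳ _)) refl (m+n≤o⇒m≤o b (≤-reflexive be≡)) ≤-refl ∷ low-near y≤

coordinatewise-runs : Σ[ p ∈ Poly ] (∀ {W} a K low cs →
  Cells (box W) (+ (box W + box W)) low (target W) cs → sums low cs ≡ target W → length cs ≡ length low →
  All (λ c → ∣ c ∣ ≤ K) cs → length low ≤ size W → length low * K + length low * K ≤ size W →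
  Runs W (low ∷ a ∷ + box W ∷ []) coordinatewise (target W) p (length low * 2))
coordinatewise-runs = _ , λ {W} a K low cs cells sum≡ cs≡ cs≤ low≤ small →
  value sum≡ (weaken-queries (≤-reflexive (trans (+-identityʳ _) (cong (_* 2) (unitRows-length (length low)))))
    (call-runs
      (pair-runs (var-runs _)
        (value (subst (λ m → codeword (unitRows m) cs ≡ cs) cs≡ (unitRows-dot cs))
          (call-runs
            (pair-runs (fst-runs (call-runs (var-runs _) (proj₂ units-runs low low≤)))
              (pair-runs (var-runs _) (add-runs (var-runs _) (var-runs _))))
            (proj₂ responses-runs cells (≤-trans (≤-reflexive (unitRows-length (length low))) low≤)
              (rows-good K low cs cs≡ cs≤ low≤ small)))))
      (proj₂ sumL-runs low cs low≤)))
  where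
  rows-good : ∀ {s} K (low cs : List ℤ) → length cs ≡ length low → All (λ c → ∣ c ∣ ≤ K) cs →
    length low ≤ s → length low * K + length low * K ≤ s →
    All (λ rs → All Trit rs × length low ≤ length rs × length rs ≤ s × ∣ dot rs cs ℤ.+ dot rs cs ∣ ≤ s)
      (unitRows (length low))
  rows-good {s} K low cs cs≡ cs≤ low≤ small = All.map good (unitRows-rows (length low))
    where
    good : ∀ {rs} → Row (length low) rs → All Trit rs × length low ≤ length rs × length rs ≤ s ×
           ∣ dot rs cs ℤ.+ dot rs cs ∣ ≤ s
    good {rs} (len , ts) = ts , ≤-reflexive (sym len) , ≤-trans (≤-reflexive len) low≤ ,
      ≤-trans (ℤ.∣i+j∣≤∣i∣+∣j∣ (dot rs cs) (dot rs cs)) (≤-trans (+-mono-≤ d≤ d≤) small)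
      where
      d≤ : ∣ dot rs cs ∣ ≤ length low * K
      d≤ = ≤-trans (dot-≤ ts cs≤) (≤-reflexive (cong (_* K) cs≡))

logarithmic-runs : Σ[ p ∈ Poly ] (∀ {W} n L low → 2 ≤ n → length low ≡ n →
  Pointwise (Near (box W) (box W + box W)) low (target W) → n + (n + n) + (n + (n + n)) ≤ size W →
  box W + box W < 2 ^ L → L ≤ size W → box W + box W ≤ size W →
  Σ[ r ∈ ℕ ] cols r < n × n ≤ cols (suc r) ×
    Runs W (low ∷ + n ∷ + box W ∷ []) logarithmic (target W) p (L * (2 ^ suc r * 2)))
logarithmic-runs = _ , λ {W} n L low 2≤n low≡ nears 6n≤ k< L≤ k≤ →
  let (r , below , reached , M) = proj₂ matrix-runs {W} n 2≤n
        (≤-trans (m≤m+n n (n + n)) (≤-trans (m≤m+n _ _) 6n≤))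
      -- The chosen matrix has at most 3n columns, as 2^r ≤ `cols r` < n, and the search needs room
      -- for twice as many; this is the origin of 6n.
      cols≤ = +-mono-≤ (<⇒≤ below) (+-mono-≤ (<⇒≤ below) (≤-trans (2^r≤cols r) (<⇒≤ below)))
  in r , below , reached ,
     call-runs (pair-runs (call-runs (var-runs _) M)
         (pair-runs (add-runs (var-runs _) (var-runs _)) (var-runs _)))
       (proj₂ search-runs (suc r) L (box W + box W) low k< L≤ nears
         (≤-trans (≤-reflexive low≡) reached) (≤-trans (+-mono-≤ cols≤ cols≤) 6n≤) k≤)

-- Each branch is correct only under its own condition, whereas the time polynomial must be the same
-- in both cases. The branches are therefore hypotheses, and the polynomial is fixed before n and k
-- are compared.
recover-branches : Σ[ p ∈ Poly ] (∀ {W} n S → (let k = box W; low = replicate n (ℤ.- + k)) → n ≤ size W →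
  (n ≤ k → Runs W (low ∷ + n ∷ + k ∷ []) coordinatewise (target W) (proj₁ coordinatewise-runs) S) →
  (k < n → Runs W (low ∷ + n ∷ + k ∷ []) logarithmic (target W) (proj₁ logarithmic-runs) S) →
  Runs W (+ n ∷ + k ∷ []) recover (target W) p S)
recover-branches = _ , λ {W} n S n≤ few many →
  let-runs
    (call-runs (pair-runs (var-runs _) (value (ℤ.+-identityˡ (ℤ.- + box W)) (sub-runs (lit-runs _) (var-runs _))))
      (proj₂ copies-runs n _ n≤))
    (if-runs (leq-runs (var-runs _) (var-runs _))
      (λ eq → few (≤-from eq)) (λ eq → many (<-from eq)))
  where
  ≤-from : ∀ {n k} → (+ n ℤ.≤ᵇ + k) ≡ true → n ≤ k
  ≤-from eq = ≤ᵇ⇒≤ _ _ (subst T (sym eq) tt)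
  <-from : ∀ {n k} → (+ n ℤ.≤ᵇ + k) ≡ false → k < n
  <-from eq = ≰⇒> λ n≤k → subst T eq (≤⇒≤ᵇ n≤k)

-- Bounds

poly-bound : ∀ p → Σ[ c ∈ ℕ ] Σ[ d ∈ ℕ ] (∀ b → 1 ≤ b → eval p b ≤ c * b ^ d)
poly-bound (con c) = c , 0 , λ b _ → ≤-reflexive (sym (*-identityʳ c))
poly-bound X = 1 , 1 , λ b _ → ≤-reflexive (sym (trans (+-identityʳ _) (*-identityʳ b)))
poly-bound (p :+ q) with poly-bound p | poly-bound q
... | c , d , p≤ | c′ , d′ , q≤ = c + c′ , d + d′ , λ { b@(suc _) 1≤b → ≤-trans
  (+-mono-≤ (≤-trans (p≤ b 1≤b) (*-monoʳ-≤ c (^-monoʳ-≤ b (m≤m+n d d′))))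
            (≤-trans (q≤ b 1≤b) (*-monoʳ-≤ c′ (^-monoʳ-≤ b (m≤n+m d′ d)))))
  (≤-reflexive (sym (*-distribʳ-+ (b ^ (d + d′)) c c′))) }
poly-bound (p :* q) with poly-bound p | poly-bound q
... | c , d , p≤ | c′ , d′ , q≤ = c * c′ , d + d′ , λ b 1≤b → ≤-trans
  (*-mono-≤ (p≤ b 1≤b) (q≤ b 1≤b))
  (≤-reflexive (trans (interchange c (b ^ d) c′ (b ^ d′)) (cong (c * c′ *_) (sym (^-distribˡ-+-* b d d′)))))
  where
  interchange : ∀ a b c d → a * b * (c * d) ≡ a * c * (b * d)
  interchange = ℕ.solve-∀

-- Doubled to avoid the power 2^(r-1). There are about r/2 columns for each row, which is the whole
-- advantage over unit vectors.
cols-double : ∀ r → cols r + cols r ≡ 2 ^ r * (2 + r)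
cols-double zero    = refl
cols-double (suc r) = begin
  cols r + (cols r + 2 ^ r) + (cols r + (cols r + 2 ^ r)) ≡⟨ regroup (cols r) (2 ^ r) ⟩
  2 * (cols r + cols r) + 2 * 2 ^ r                       ≡⟨ cong (λ l → 2 * l + 2 * 2 ^ r) (cols-double r) ⟩
  2 * (2 ^ r * (2 + r)) + 2 * 2 ^ r                       ≡⟨ factor (2 ^ r) r ⟩
  2 ^ suc r * (2 + suc r)                                 ∎
  where
  open ≡-Reasoning
  regroup : ∀ c m → c + (c + m) + (c + (c + m)) ≡ 2 * (c + c) + 2 * m
  regroup = ℕ.solve-∀
  factor : ∀ m r → 2 * (m * (2 + r)) + 2 * m ≡ 2 * m * (2 + suc r)
  factor = ℕ.solve-∀

-- Crude, but it gives log₂ n ≤ 2 (r + 1), of the right order in r.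
cols≤4^ : ∀ r → cols r ≤ 4 ^ r
cols≤4^ zero    = ≤-refl
cols≤4^ (suc r) = +-mono-≤ c≤ (+-mono-≤ c≤ (≤-trans (2^r≤cols r) (≤-trans c≤ (m≤m+n (4 ^ r) (4 ^ r + 0)))))
  where
  c≤ = cols≤4^ r

-- The exponential form of B log₂ n ≤ 16 n for the B = 4 · 2^r queries of a round. With log₂ n ≤ 2
-- (r + 1) the left side is at most 8 · 2^r (r + 1), and 2^r (r + 2) = 2 `cols r` is below 2n.
round-queries : ∀ {n} r → cols r < n → n ≤ cols (suc r) → n ^ (2 ^ suc r * 2) ≤ 2 ^ (16 * n)
round-queries {n} r below reached = begin
  n ^ B                         ≤⟨ ^-monoˡ-≤ B (≤-trans reached (cols≤4^ (suc r))) ⟩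
  ((2 ^ 2) ^ suc r) ^ B         ≡⟨ cong (_^ B) (^-*-assoc 2 2 (suc r)) ⟩
  (2 ^ (2 * suc r)) ^ B         ≡⟨ ^-*-assoc 2 (2 * suc r) B ⟩
  2 ^ (2 * suc r * B)           ≤⟨ ^-monoʳ-≤ 2 exponent ⟩
  2 ^ (16 * n)                  ∎
  where
  open ≤-Reasoning
  B = 2 ^ suc r * 2
  expand : ∀ m r → 2 * suc r * (2 * m * 2) ≡ 8 * (m * suc r)
  expand = ℕ.solve-∀
  collect : ∀ c → 8 * (c + c) ≡ 16 * c
  collect = ℕ.solve-∀
  exponent : 2 * suc r * B ≤ 16 * n
  exponent = begin
    2 * suc r * B           ≡⟨ expand (2 ^ r) r ⟩
    8 * (2 ^ r * suc r)     ≤⟨ *-monoʳ-≤ 8 (*-monoʳ-≤ (2 ^ r) (n≤1+n (suc r))) ⟩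
    8 * (2 ^ r * (2 + r))   ≡⟨ cong (8 *_) (cols-double r) ⟨
    8 * (cols r + cols r)   ≡⟨ collect (cols r) ⟩
    16 * cols r             ≤⟨ *-monoʳ-≤ 16 (<⇒≤ below) ⟩
    16 * n                  ∎

-- Turns 2^L ≤ 4k into L ≤ 3 log₂ m. It is applied with m = 2 ⊔ k and with m = n, once for each half
-- of the query bound.
four-times : ∀ {m k} → 2 ≤ m → k ≤ m → k + k + (k + k) ≤ m ^ 3
four-times {m} {k} 2≤m k≤m = ≤-trans (≤-reflexive (regroup k))
  (*-mono-≤ 2≤m (*-mono-≤ 2≤m (≤-trans k≤m (≤-reflexive (sym (*-identityʳ m))))))
  where
  regroup : ∀ k → k + k + (k + k) ≡ 2 * (2 * k)
  regroup = ℕ.solve-∀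

^-swap : ∀ m a b → (m ^ a) ^ b ≡ (m ^ b) ^ a
^-swap m a b = trans (^-*-assoc m a b) (trans (cong (m ^_) (*-comm a b)) (sym (^-*-assoc m b a)))

-- Both halves multiply B log₂ n ≤ 16 n by a bound on L. With L ≤ 3 log₂ (2 ⊔ k) this is the power
-- bound; with L ≤ 3 log₂ n, where k < n enters, log₂ n cancels and the linear bound remains.
logarithmic-queries : ∀ {n k} L B → 2 ≤ n → k < n → n ^ B ≤ 2 ^ (16 * n) →
  2 ^ L ≤ k + k + (k + k) → QueryBound 48 n k (L * B)
logarithmic-queries {n} {k} L B 2≤n k<n B≤ L≤ = linear , power
  where
  open ≤-Reasoning
  triple : ∀ n → 3 * (16 * n) ≡ 48 * n
  triple = ℕ.solve-∀
  power : n ^ (L * B) ≤ (2 ⊔ k) ^ (48 * n)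
  power = begin
    n ^ (L * B)                 ≡⟨ cong (n ^_) (*-comm L B) ⟩
    n ^ (B * L)                 ≡⟨ ^-*-assoc n B L ⟨
    (n ^ B) ^ L                 ≤⟨ ^-monoˡ-≤ L B≤ ⟩
    (2 ^ (16 * n)) ^ L          ≡⟨ ^-swap 2 (16 * n) L ⟩
    (2 ^ L) ^ (16 * n)          ≤⟨ ^-monoˡ-≤ (16 * n) (≤-trans L≤ (four-times (m≤m⊔n 2 k) (m≤n⊔m 2 k))) ⟩
    ((2 ⊔ k) ^ 3) ^ (16 * n)    ≡⟨ ^-*-assoc (2 ⊔ k) 3 (16 * n) ⟩
    (2 ⊔ k) ^ (3 * (16 * n))    ≡⟨ cong ((2 ⊔ k) ^_) (triple n) ⟩
    (2 ⊔ k) ^ (48 * n)          ∎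
  linear′ : 2 ^ (L * B) ≤ 2 ^ (48 * n)
  linear′ = begin
    2 ^ (L * B)                 ≡⟨ ^-*-assoc 2 L B ⟨
    (2 ^ L) ^ B                 ≤⟨ ^-monoˡ-≤ B (≤-trans L≤ (four-times 2≤n (<⇒≤ k<n))) ⟩
    (n ^ 3) ^ B                 ≡⟨ ^-swap n 3 B ⟩
    (n ^ B) ^ 3                 ≤⟨ ^-monoˡ-≤ 3 B≤ ⟩
    (2 ^ (16 * n)) ^ 3          ≡⟨ ^-*-assoc 2 (16 * n) 3 ⟩
    2 ^ (16 * n * 3)            ≡⟨ cong (2 ^_) (trans (*-comm (16 * n) 3) (triple n)) ⟩
    2 ^ (48 * n)                ∎
  linear : L * B ≤ 48 * n
  linear = ≮⇒≥ λ lt → <⇒≱ (^-monoʳ-< 2 (s≤s (s≤s z≤n)) lt) linear′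

coordinatewise-queries : ∀ {n k} → n ≤ k → QueryBound 48 n k (n * 2)
coordinatewise-queries {n} {k} n≤k = linear , (begin
    n ^ (n * 2)          ≤⟨ ^-monoˡ-≤ (n * 2) (≤-trans n≤k (m≤n⊔m 2 k)) ⟩
    (2 ⊔ k) ^ (n * 2)    ≤⟨ ^-monoʳ-≤ (2 ⊔ k) {{>-nonZero (≤-trans (s≤s z≤n) (m≤m⊔n 2 k))}} linear ⟩
    (2 ⊔ k) ^ (48 * n)   ∎)
  where
  open ≤-Reasoning
  linear : n * 2 ≤ 48 * n
  linear = ≤-trans (≤-reflexive (*-comm n 2)) (*-monoˡ-≤ n (m≤m+n 2 46))

-- The number of binary digits of `suc w`. The successor excludes 0, for which no power of two meets
-- the upper bound.
logarithm : ∀ w → Σ[ L ∈ ℕ ] suc w < 2 ^ L × 2 ^ L ≤ suc w + suc w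
logarithm zero = 1 , ≤-refl , ≤-refl
logarithm (suc w) with logarithm w
... | L , below , above with 2 + w <? 2 ^ L
...   | yes below′ = L , below′ , ≤-trans above (+-mono-≤ (n≤1+n (suc w)) (n≤1+n (suc w)))
...   | no  done   = suc L ,
  +-mono-≤ (m^n>0 2 L) (≤-trans below (m≤m+n (2 ^ L) 0)) ,
  +-mono-≤ (≮⇒≥ done) (≤-trans (≤-reflexive (+-identityʳ (2 ^ L))) (≮⇒≥ done))

n≤2^n : ∀ n → n ≤ 2 ^ n
n≤2^n zero    = z≤n
n≤2^n (suc n) = +-mono-≤ (m^n>0 2 n) (≤-trans (n≤2^n n) (m≤m+n (2 ^ n) 0))

-- One size for all loops. It is quadratic because of the coordinatewise branch, where twice a
-- product with a row is bounded by 2 · n · 2k; the other quantities, up to 6n and 4k, are linear,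
-- and the factor 8 covers them all.
bound : ℕ → ℕ → ℕ
bound n k = 8 * ((n + k) * (n + k))

linear≤bound : ∀ {n k m} → 1 ≤ n → m ≤ 8 * (n + k) → m ≤ bound n k
linear≤bound {n} {k} 1≤n m≤ = ≤-trans m≤ (*-monoʳ-≤ 8
  (≤-trans (≤-reflexive (sym (*-identityʳ (n + k)))) (*-monoʳ-≤ (n + k) (≤-trans 1≤n (m≤m+n n k)))))

n≤bound : ∀ {n k} → 1 ≤ n → n ≤ bound n k
n≤bound {n} {k} 1≤n = linear≤bound 1≤n (≤-trans (m≤m+n n k) (m≤m+n (n + k) (7 * (n + k))))

6n≤bound : ∀ {n k} → 1 ≤ n → n + (n + n) + (n + (n + n)) ≤ bound n k
6n≤bound {n} {k} 1≤n = linear≤bound 1≤n (≤-trans (≤-reflexive (six n)) (*-mono-≤ (m≤m+n 6 2) (m≤m+n n k)))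
  where
  six : ∀ n → n + (n + n) + (n + (n + n)) ≡ 6 * n
  six = ℕ.solve-∀

4k≤bound : ∀ {n k} → 1 ≤ n → k + k + (k + k) ≤ bound n k
4k≤bound {n} {k} 1≤n = linear≤bound 1≤n (≤-trans (≤-reflexive (four k)) (*-mono-≤ (m≤m+n 4 4) (m≤n+m k n)))
  where
  four : ∀ k → k + k + (k + k) ≡ 4 * k
  four = ℕ.solve-∀

4nk≤bound : ∀ n k → n * (k + k) + n * (k + k) ≤ bound n k
4nk≤bound n k = ≤-trans (≤-reflexive (four n k)) (*-mono-≤ (m≤m+n 4 4) (*-mono-≤ (m≤m+n n k) (m≤n+m k n)))
  where
  four : ∀ n k → n * (k + k) + n * (k + k) ≡ 4 * (n * k)
  four = ℕ.solve-∀

-- Assembly of the two cases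

recover-runs : ∀ {n k} → 2 ≤ n → 1 ≤ k → (y : Vec ℤ n) → InBox k y →
  Σ[ S ∈ ℕ ] QueryBound 48 n k S ×
    Runs (world k y (bound n k)) (+ n ∷ + k ∷ []) recover (Vec.toList y) (proj₁ recover-branches) S
recover-runs {n} {suc k′} 2≤n 1≤k y inside = choose (n ≤? k)
  where
  k   = suc k′
  V   = world k y (bound n k)
  low = replicate n (ℤ.- + k)
  1≤n : 1 ≤ n
  1≤n = ≤-trans (n≤1+n 1) 2≤n
  low≡ : length low ≡ n
  low≡ = length-replicate n
  Result : Set
  Result = Σ[ S ∈ ℕ ] QueryBound 48 n k S ×
    Runs V (+ n ∷ + k ∷ []) recover (Vec.toList y) (proj₁ recover-branches) S
  choose : Dec (n ≤ k) → Result
  choose (yes n≤k) =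
    let (cs , cs≤ , cs≡ , cells , sum≡) = low-cells inside
    in  n * 2 , coordinatewise-queries n≤k ,
        proj₂ recover-branches n (n * 2) (n≤bound 1≤n)
          (λ _ → subst (λ m → Runs V (low ∷ + n ∷ + k ∷ []) coordinatewise (Vec.toList y) (proj₁ coordinatewise-runs) (m * 2))
            low≡
            (proj₂ coordinatewise-runs (+ n) (k + k) low cs cells sum≡ (trans cs≡ (sym low≡)) cs≤
              (≤-trans (≤-reflexive low≡) (n≤bound 1≤n))
              (≤-trans (≤-reflexive (cong (λ m → m * (k + k) + m * (k + k)) low≡)) (4nk≤bound n k))))
          (λ k<n → contradiction n≤k (<⇒≱ k<n))
  choose (no n≰k) =
    -- The first width is 2k, which is `suc (k′ + k)` by computation; hence 2k < 2^L ≤ 4k.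
    let (L , below , above) = logarithm (k′ + k)
        (r , narrow , reached , R) = proj₂ logarithmic-runs {V} n L low 2≤n low≡ (low-near inside) (6n≤bound 1≤n)
          below (≤-trans (n≤2^n L) (≤-trans above (4k≤bound 1≤n)))
          (≤-trans (m≤m+n (k + k) (k + k)) (4k≤bound 1≤n))
        B = 2 ^ suc r * 2
    in  L * B , logarithmic-queries L B 2≤n (≰⇒> n≰k) (round-queries r narrow reached) above ,
        proj₂ recover-branches n (L * B) (n≤bound 1≤n) (λ n≤k → contradiction n≤k n≰k) (λ _ → R)

bound-^ : ∀ n k d → bound n k ^ d ≡ 8 ^ d * (n + k) ^ (2 * d)
bound-^ n k d = trans (^-distribʳ-* d 8 (N * N)) (cong (8 ^ d *_)
  (trans (cong (λ m → (N * m) ^ d) (sym (*-identityʳ N))) (^-*-assoc N 2 d)))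
  where
  N = n + k
  ^-distribʳ-* : ∀ d a b → (a * b) ^ d ≡ a ^ d * b ^ d
  ^-distribʳ-* zero    a b = refl
  ^-distribʳ-* (suc d) a b = trans (cong (a * b *_) (^-distribʳ-* d a b)) (swap a b (a ^ d) (b ^ d))
    where
    swap : ∀ a b c d → a * b * (c * d) ≡ a * c * (b * d)
    swap = ℕ.solve-∀

mainTheorem2 : Σ[ P ∈ Algorithm ] Σ[ C ∈ ℕ ] Σ[ c ∈ ℕ ] Σ[ d ∈ ℕ ]
    ((n k : ℕ) → 2 ≤ n → 1 ≤ k → (y : Vec ℤ n) → InBox k y →
    Σ[ t ∈ ℕ ] Σ[ s ∈ ℕ ]
    (Recovers P k y t s × QueryBound C n k s × t ≤ c * (n + k) ^ d))
-- The time polynomial is at most c b^d at b = 8 (n + k)^2, that is, c 8^d (n + k)^(2d).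
mainTheorem2 = recover , 48 , c * 8 ^ d , 2 * d , λ n k 2≤n 1≤k y inside →
  let (S , (linear , power) , runs {t} {s} derivation t≤ s≤) = recover-runs 2≤n 1≤k y inside
      1≤n = ≤-trans (n≤1+n 1) 2≤n
  in  t , s , derivation ,
      (≤-trans s≤ linear , ≤-trans (^-monoʳ-≤ n {{>-nonZero 1≤n}} s≤) power) ,
      ≤-trans t≤ (≤-trans (eval≤ (bound n k) (≤-trans 1≤n (n≤bound 1≤n)))
        (≤-reflexive (trans (cong (c *_) (bound-^ n k d)) (sym (*-assoc c (8 ^ d) ((n + k) ^ (2 * d)))))))
  where
  time-bound = proj₁ recover-branches
  c = proj₁ (poly-bound time-bound)
  d = proj₁ (proj₂ (poly-bound time-bound))
  eval≤ : ∀ b → 1 ≤ b → eval time-bound b ≤ c * b ^ d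
  eval≤ = proj₂ (proj₂ (poly-bound time-bound))
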